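{- For every integer $d\geq 1$, every bipartite graph that contains none of the armchair, the stirrer, the tripod and $K_{d+1,d+1}$ as an induced subgraph has pathwidth at most $4d-1$.
   Context: The armchair is a 4-cycle $abcd$ with one pendant vertex attached to each of $a,b,c$ (7 vertices); the stirrer is the domino (two 4-cycles sharing an edge, i.e. the $2\times3$ grid) with one pendant vertex attached to one of its two degree-3 vertices; the tripod is $K_{1,3}$ with each edge subdivided once. A path decomposition of $G=(V,E)$ is a sequence $(B_1,\dots,B_r)$ of subsets of $V$ such that every vertex lies in some $B_i$, every edge is contained in some $B_i$, and for each vertex $v$ the set $\{i: v\in B_i\}$ is an interval; its width is $\max_i|B_i|-1$, and the pathwidth is the minimum width. -}

module Defs where

open import Data.Nat using (ℕ; zero; suc; _+_; _*_; _≤_; _<ᵇ_; _≡ᵇ_)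
open import Data.Bool using (Bool; true; false; _∨_; _∧_; _xor_; not)
open import Data.Bool.Properties using (∨-comm)
open import Data.Fin using (Fin; toℕ)
open import Data.Fin.Subset using (Subset; _∈_; ∣_∣)
open import Data.List using (List; []; _∷_; any)
open import Data.Product using (Σ; _×_; _,_; ∃)
open import Function.Definitions using (Injective)
open import Relation.Binary.PropositionalEquality using (_≡_; _≢_; refl)

record Graph : Set where
  field
    n        : ℕ
    adj      : Fin n → Fin n → Bool
    sym      : ∀ u v → adj u v ≡ adj v u
    loopless : ∀ u → adj u u ≡ false
open Graph public

Bipartite : Graph → Set
Bipartite G = Σ (Fin (n G) → Bool) λ c →
  ∀ u v → adj G u v ≡ true → c u ≢ c v

_InducedIn_ : Graph → Graph → Set
H InducedIn G = Σ (Fin (n H) → Fin (n G)) λ f →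
  Injective _≡_ _≡_ f × (∀ u v → adj G (f u) (f v) ≡ adj H u v)

InducedFree : Graph → Graph → Set
InducedFree G H = H InducedIn G → Data.Empty.⊥
  where import Data.Empty

record PathDecomposition (G : Graph) : Set where
  field
    r        : ℕ
    bag      : Fin r → Subset (n G)
    covers-vertices : ∀ v → ∃ λ i → v ∈ bag i
    covers-edges    : ∀ u v → adj G u v ≡ true → ∃ λ i → (u ∈ bag i × v ∈ bag i)
    interval : ∀ v (i j k : Fin r) → toℕ i ≤ toℕ j → toℕ j ≤ toℕ k →
               v ∈ bag i → v ∈ bag k → v ∈ bag j
open PathDecomposition public

PathwidthAtMost : Graph → ℕ → Set
PathwidthAtMost G w = Σ (PathDecomposition G) λ P →
  ∀ i → ∣ bag P i ∣ ≤ suc w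

private
  hasEdge : List (ℕ × ℕ) → ℕ → ℕ → Bool
  hasEdge [] a b = false
  hasEdge ((x , y) ∷ es) a b = ((x ≡ᵇ a) ∧ (y ≡ᵇ b)) ∨ hasEdge es a b

  edgeAdj : ∀ {k} → List (ℕ × ℕ) → Fin k → Fin k → Bool
  edgeAdj es u v = hasEdge es (toℕ u) (toℕ v) ∨ hasEdge es (toℕ v) (toℕ u)

  edgeSym : ∀ {k} (es : List (ℕ × ℕ)) (u v : Fin k) → edgeAdj es u v ≡ edgeAdj es v u
  edgeSym es u v = ∨-comm (hasEdge es (toℕ u) (toℕ v)) (hasEdge es (toℕ v) (toℕ u))

-- Armchair: 4-cycle 0-1-2-3-0 (a,b,c,d), pendants 4,5,6 attached to 0,1,2.
armchairEdges : List (ℕ × ℕ)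
armchairEdges = (0 , 1) ∷ (1 , 2) ∷ (2 , 3) ∷ (3 , 0) ∷ (0 , 4) ∷ (1 , 5) ∷ (2 , 6) ∷ []

armchair : Graph
armchair = record
  { n = 7 ; adj = edgeAdj armchairEdges ; sym = edgeSym armchairEdges
  ; loopless = λ { Fin.zero → refl ; (Fin.suc Fin.zero) → refl
                 ; (Fin.suc (Fin.suc Fin.zero)) → refl
                 ; (Fin.suc (Fin.suc (Fin.suc Fin.zero))) → refl
                 ; (Fin.suc (Fin.suc (Fin.suc (Fin.suc Fin.zero)))) → refl
                 ; (Fin.suc (Fin.suc (Fin.suc (Fin.suc (Fin.suc Fin.zero))))) → refl
                 ; (Fin.suc (Fin.suc (Fin.suc (Fin.suc (Fin.suc (Fin.suc Fin.zero)))))) → refl } }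
  where import Data.Fin as Fin

-- Stirrer: 2×3 grid with rows 0-1-2 and 3-4-5 (columns 0-3,1-4,2-5);
-- the degree-3 vertices are 1 and 4; pendant 6 attached to 1.
stirrerEdges : List (ℕ × ℕ)
stirrerEdges = (0 , 1) ∷ (1 , 2) ∷ (3 , 4) ∷ (4 , 5) ∷ (0 , 3) ∷ (1 , 4) ∷ (2 , 5) ∷ (1 , 6) ∷ []

stirrer : Graph
stirrer = record
  { n = 7 ; adj = edgeAdj stirrerEdges ; sym = edgeSym stirrerEdges
  ; loopless = λ { Fin.zero → refl ; (Fin.suc Fin.zero) → refl
                 ; (Fin.suc (Fin.suc Fin.zero)) → refl
                 ; (Fin.suc (Fin.suc (Fin.suc Fin.zero))) → refl
                 ; (Fin.suc (Fin.suc (Fin.suc (Fin.suc Fin.zero)))) → refl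
                 ; (Fin.suc (Fin.suc (Fin.suc (Fin.suc (Fin.suc Fin.zero))))) → refl
                 ; (Fin.suc (Fin.suc (Fin.suc (Fin.suc (Fin.suc (Fin.suc Fin.zero)))))) → refl } }
  where import Data.Fin as Fin

-- Tripod: K_{1,3} with each edge subdivided: centre 0, legs 0-1-2, 0-3-4, 0-5-6.
tripodEdges : List (ℕ × ℕ)
tripodEdges = (0 , 1) ∷ (1 , 2) ∷ (0 , 3) ∷ (3 , 4) ∷ (0 , 5) ∷ (5 , 6) ∷ []

tripod : Graph
tripod = record
  { n = 7 ; adj = edgeAdj tripodEdges ; sym = edgeSym tripodEdges
  ; loopless = λ { Fin.zero → refl ; (Fin.suc Fin.zero) → refl
                 ; (Fin.suc (Fin.suc Fin.zero)) → refl
                 ; (Fin.suc (Fin.suc (Fin.suc Fin.zero))) → refl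
                 ; (Fin.suc (Fin.suc (Fin.suc (Fin.suc Fin.zero)))) → refl
                 ; (Fin.suc (Fin.suc (Fin.suc (Fin.suc (Fin.suc Fin.zero))))) → refl
                 ; (Fin.suc (Fin.suc (Fin.suc (Fin.suc (Fin.suc (Fin.suc Fin.zero)))))) → refl } }
  where import Data.Fin as Fin

private
  xor-comm : ∀ a b → a xor b ≡ b xor a
  xor-comm false false = refl
  xor-comm false true  = refl
  xor-comm true  false = refl
  xor-comm true  true  = refl

  xor-self : ∀ a → a xor a ≡ false
  xor-self false = refl
  xor-self true  = refl

completeBipartite : ℕ → Graph
completeBipartite m = record
  { n = m + m
  ; adj = λ u v → (toℕ u <ᵇ m) xor (toℕ v <ᵇ m)
  ; sym = λ u v → xor-comm (toℕ u <ᵇ m) (toℕ v <ᵇ m)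
  ; loopless = λ u → xor-self (toℕ u <ᵇ m) }

{-# OPTIONS --safe #-}

-- A layering in which consecutive levels induce chain graphs, with compatible upper and lower inclusions on each level,
-- orders both colour classes strongly. Merging the two orders so that every cut has at most d boundary vertices of each
-- colour (d + 1 of both would span K_{d+1,d+1}) gives bags of size 2d. So it suffices to find, in each component, at
-- most 2d vertices whose removal leaves such layered pieces.
--
-- If all vertices with a common neighbour have comparable neighbourhoods, the component itself is a chain graph.
-- Otherwise take incomparable x, y with a nonempty common neighbourhood K, minimising |K| and then maximising
-- |N(x) ∪ N(y)|. In the sparse case a vertex adjacent to K either sees all of K or nothing outside K. The vertices
-- complete to K form chain graphs with N(x) ∖ K and N(y) ∖ K, and a vertex cover of the second one, of size at most 2d,
-- cuts the component into two arms. Breadth-first levels of an arm are chain graphs since there is no tripod, and are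
-- compatible since there is no armchair; holes do no harm, as they merely close up an arm that is already cut.
--
-- In the dense case there is a six-cycle with a vertex adjacent to three of its vertices. Then the bipartite complement
-- of the component has no induced P₅, so it is a disjoint union of chain graphs. Either a colour class has fewer than
-- 4d vertices, or one of these blocks contains all but d vertices of each colour.
module Submission where

open import Defs
open import Data.Nat using (ℕ; suc; _*_; _∸_; _≥_)
open import Data.Nat as ℕ using (zero; _+_; _≤_; _<_; _<ᵇ_; z≤n; s≤s; _≤?_; _<?_; _≤′_; ≤′-refl; ≤′-step)
open import Data.Nat.Properties
open import Data.Bool using (Bool; true; false; not; _xor_)
import Data.Bool.Properties as Bool
open import Data.Fin using (Fin; zero; suc; toℕ; fromℕ<; splitAt; combine; remQuot; _↑ˡ_; _↑ʳ_)
import Data.Fin.Properties as Fin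
open import Data.Fin.Properties using (any?; all?)
open import Data.Fin.Subset using (_∈_; ∣_∣)
open import Data.Vec using ([]; _∷_; tabulate; lookup)
open import Data.Vec.Properties using (lookup∘tabulate; lookup⇒[]=; []=⇒lookup)
open import Data.Product using (Σ; ∃; ∃₂; _×_; _,_; proj₁; proj₂)
open import Data.Sum using (_⊎_; inj₁; inj₂; [_,_]′)
open import Data.Empty using (⊥; ⊥-elim)
open import Data.Unit using (⊤; tt)
open import Function using (_∘_; id; case_of_)
open import Function.Definitions using (Injective)
open import Relation.Nullary using (¬_; Dec; yes; no; contradiction; does)
open import Relation.Nullary.Decidable using (_×-dec_; _⊎-dec_; _→-dec_; ¬?; toWitness; decidable-stable)
open import Relation.Unary using (Decidable)
open import Relation.Binary.Definitions using (tri<; tri≈; tri>)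
open import Relation.Binary.PropositionalEquality
  using (_≡_; _≢_; refl; trans; cong; subst) renaming (sym to ≡-sym)

-- Counting, choice and extremal elements in finite sets

indicator : {A : Set} → Dec A → ℕ
indicator (yes _) = 1
indicator (no _)  = 0

count : ∀ {m} {P : Fin m → Set} → Decidable P → ℕ
count {zero}  P? = 0
count {suc m} P? = indicator (P? zero) + count (P? ∘ suc)

count≤m : ∀ {m} {P : Fin m → Set} (P? : Decidable P) → count P? ≤ m
count≤m {zero}  P? = z≤n
count≤m {suc m} P? with P? zero
... | yes _ = s≤s (count≤m (P? ∘ suc))
... | no _  = m≤n⇒m≤1+n (count≤m (P? ∘ suc))

count-mono : ∀ {m} {P Q : Fin m → Set} (P? : Decidable P) (Q? : Decidable Q) →
  (∀ i → P i → Q i) → count P? ≤ count Q?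
count-mono {zero}  P? Q? P⊆Q = z≤n
count-mono {suc m} P? Q? P⊆Q with P? zero | Q? zero
... | yes p | yes _ = s≤s (count-mono (P? ∘ suc) (Q? ∘ suc) (P⊆Q ∘ suc))
... | yes p | no ¬q = contradiction (P⊆Q zero p) ¬q
... | no _  | yes _ = m≤n⇒m≤1+n (count-mono (P? ∘ suc) (Q? ∘ suc) (P⊆Q ∘ suc))
... | no _  | no _  = count-mono (P? ∘ suc) (Q? ∘ suc) (P⊆Q ∘ suc)

count-strict : ∀ {m} {P Q : Fin m → Set} (P? : Decidable P) (Q? : Decidable Q) →
  (∀ i → P i → Q i) → ∀ i → Q i → ¬ P i → count P? < count Q?
count-strict P? Q? P⊆Q zero q ¬p with P? zero | Q? zero
... | yes p | _     = contradiction p ¬p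
... | no _  | yes _ = s≤s (count-mono (P? ∘ suc) (Q? ∘ suc) (P⊆Q ∘ suc))
... | no _  | no ¬q = contradiction q ¬q
count-strict P? Q? P⊆Q (suc i) q ¬p with P? zero | Q? zero
... | yes _ | yes _ = s≤s (count-strict (P? ∘ suc) (Q? ∘ suc) (P⊆Q ∘ suc) i q ¬p)
... | yes p | no ¬q = contradiction (P⊆Q zero p) ¬q
... | no _  | yes _ = m≤n⇒m≤1+n (count-strict (P? ∘ suc) (Q? ∘ suc) (P⊆Q ∘ suc) i q ¬p)
... | no _  | no _  = count-strict (P? ∘ suc) (Q? ∘ suc) (P⊆Q ∘ suc) i q ¬p

count-∪ : ∀ {m} {P Q R : Fin m → Set} (P? : Decidable P) (Q? : Decidable Q) (R? : Decidable R) →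
  (∀ i → P i → Q i ⊎ R i) → count P? ≤ count Q? + count R?
count-∪ {zero}  P? Q? R? cover = z≤n
count-∪ {suc m} P? Q? R? cover
  with P? zero | Q? zero | R? zero | count-∪ (P? ∘ suc) (Q? ∘ suc) (R? ∘ suc) (cover ∘ suc)
... | yes _ | yes _ | yes _ | ih = s≤s (≤-trans ih (+-monoʳ-≤ _ (n≤1+n _)))
... | yes _ | yes _ | no _  | ih = s≤s ih
... | yes _ | no _  | yes _ | ih = ≤-trans (s≤s ih) (≤-reflexive (≡-sym (+-suc _ _)))
... | yes p | no ¬q | no ¬r | ih = ⊥-elim ([ ¬q , ¬r ]′ (cover zero p))
... | no _  | yes _ | yes _ | ih = m≤n⇒m≤1+n (≤-trans ih (+-monoʳ-≤ _ (n≤1+n _)))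
... | no _  | yes _ | no _  | ih = m≤n⇒m≤1+n ih
... | no _  | no _  | yes _ | ih = ≤-trans ih (+-monoʳ-≤ _ (n≤1+n _))
... | no _  | no _  | no _  | ih = ih

count-none : ∀ {m} {P : Fin m → Set} (P? : Decidable P) → (∀ i → ¬ P i) → count P? ≡ 0
count-none {zero}  P? none = refl
count-none {suc m} P? none with P? zero
... | yes p = contradiction p (none zero)
... | no _  = count-none (P? ∘ suc) (none ∘ suc)

count-unique : ∀ {m} {P : Fin m → Set} (P? : Decidable P) →
  (∀ i j → P i → P j → i ≡ j) → count P? ≤ 1
count-unique {zero}  P? unique = z≤n
count-unique {suc m} P? unique with P? zero
... | no _  = count-unique (P? ∘ suc) (λ i j p q → Fin.suc-injective (unique (suc i) (suc j) p q))
... | yes p = s≤s (≤-reflexive (count-none (P? ∘ suc) λ i q → Fin.0≢1+n (unique zero (suc i) p q)))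

count>0 : ∀ {m} {P : Fin m → Set} (P? : Decidable P) → 0 < count P? → ∃ P
count>0 {suc m} P? pos with P? zero
... | yes p = zero , p
... | no _  = case count>0 (P? ∘ suc) pos of λ (i , p) → suc i , p

choose : ∀ {m k} {P : Fin m → Set} (P? : Decidable P) → k ≤ count P? →
  Σ (Fin k → Fin m) λ f → Injective _≡_ _≡_ f × (∀ i → P (f i))
choose {zero}  {zero} P? _ = (λ ()) , (λ { {()} }) , λ ()
choose {suc m} {zero} P? _ = (λ ()) , (λ { {()} }) , λ ()
choose {suc m} {suc k} P? k≤ with P? zero
... | no _ with choose (P? ∘ suc) k≤
...   | f , inj , Pf = suc ∘ f , inj ∘ Fin.suc-injective , Pf
choose {suc m} {suc k} P? (s≤s k≤) | yes p with choose (P? ∘ suc) k≤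
...   | f , inj , Pf = g , g-inj , Pg
  where
  g : Fin (suc k) → Fin (suc m)
  g zero    = zero
  g (suc i) = suc (f i)
  g-inj : Injective _≡_ _≡_ g
  g-inj {zero}  {zero}  _  = refl
  g-inj {suc i} {suc j} eq = cong suc (inj (Fin.suc-injective eq))
  Pg : ∀ i → _
  Pg zero    = p
  Pg (suc i) = Pf i

∣tabulate∣≤count : ∀ {m} {P : Fin m → Set} (P? : Decidable P) → ∣ tabulate (does ∘ P?) ∣ ≤ count P?
∣tabulate∣≤count {zero}  P? = z≤n
∣tabulate∣≤count {suc m} P? with P? zero
... | yes _ = s≤s (∣tabulate∣≤count (P? ∘ suc))
... | no _  = ∣tabulate∣≤count (P? ∘ suc)

∈-tabulate⁺ : ∀ {m} {P : Fin m → Set} (P? : Decidable P) {i} → P i → i ∈ tabulate (does ∘ P?)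
∈-tabulate⁺ P? {i} p = lookup⇒[]= i _ (trans (lookup∘tabulate _ i) holds)
  where
  holds : does (P? i) ≡ true
  holds with P? i
  ... | yes _ = refl
  ... | no ¬p = contradiction p ¬p

∈-tabulate⁻ : ∀ {m} {P : Fin m → Set} (P? : Decidable P) {i} → i ∈ tabulate (does ∘ P?) → P i
∈-tabulate⁻ P? {i} i∈ with P? i | trans (≡-sym (lookup∘tabulate (does ∘ P?) i)) ([]=⇒lookup i∈)
... | yes p | _  = p
... | no _  | ()

least : ∀ {m} {P : Fin m → Set} (P? : Decidable P) (_⊑_ : Fin m → Fin m → Set) →
  (∀ {i j} → P i → P j → i ⊑ j ⊎ j ⊑ i) → (∀ {i j k} → P i → P j → P k → i ⊑ j → j ⊑ k → i ⊑ k) →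
  ∃ P → ∃ λ i → P i × ∀ j → P j → i ⊑ j
least {suc m} {P} P? _⊑_ total ⊑-trans (i₀ , p₀) with any? (P? ∘ suc)
... | no none = zero , P-zero i₀ p₀ , only
  where
  P-zero : ∀ i → P i → P zero
  P-zero zero    p = p
  P-zero (suc i) p = contradiction (i , p) none
  only : ∀ j → P j → zero ⊑ j
  only zero    p = [ id , id ]′ (total p p)
  only (suc j) p = contradiction (j , p) none
... | yes some with P? zero
                  | least (P? ∘ suc) (λ i j → suc i ⊑ suc j) total ⊑-trans some
...   | no ¬p | i , p , min = suc i , p , λ { zero q → contradiction q ¬p ; (suc j) q → min j q }
...   | yes p₁ | i , p , min with total p₁ p
...     | inj₁ le = zero , p₁ , λ { zero q → [ id , id ]′ (total q q)
                                  ; (suc j) q → ⊑-trans p₁ p q le (min j q) }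
...     | inj₂ ge = suc i , p , λ { zero q → ge ; (suc j) q → min j q }

argmin : ∀ {m} {P : Fin m → Set} (P? : Decidable P) (μ : Fin m → ℕ) →
  ∃ P → ∃ λ i → P i × ∀ j → P j → μ i ≤ μ j
argmin P? μ = least P? (λ i j → μ i ≤ μ j) (λ _ _ → ≤-total _ _) (λ _ _ _ → ≤-trans)

argmax : ∀ {m} {P : Fin m → Set} (P? : Decidable P) (μ : Fin m → ℕ) →
  ∃ P → ∃ λ i → P i × ∀ j → P j → μ j ≤ μ i
argmax P? μ = least P? (λ i j → μ j ≤ μ i) (λ _ _ → ≤-total _ _) (λ _ _ _ p q → ≤-trans q p)

-- Pairs are coded as elements of `Fin (m * m)`, so that the one-variable search applies.
argmin₂ : ∀ {m} {P : Fin m → Fin m → Set} (P? : ∀ i j → Dec (P i j)) (μ : Fin m → Fin m → ℕ) →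
  ∃₂ P → ∃₂ λ i j → P i j × ∀ i′ j′ → P i′ j′ → μ i j ≤ μ i′ j′
argmin₂ {m} {P} P? μ (i₀ , j₀ , p₀) =
  case argmin (λ k → P? (proj₁ (pair k)) (proj₂ (pair k))) (λ k → μ (proj₁ (pair k)) (proj₂ (pair k)))
         (combine i₀ j₀ , at i₀ j₀ p₀) of λ
    { (k , p , min) → _ , _ , p , λ i j q →
        subst (μ (proj₁ (pair k)) (proj₂ (pair k)) ≤_) (cong (λ (a , b) → μ a b) (Fin.remQuot-combine i j)) (min (combine i j) (at i j q)) }
  where
  pair : Fin (m * m) → Fin m × Fin m
  pair = remQuot m
  at : ∀ i j → P i j → P (proj₁ (pair (combine i j))) (proj₂ (pair (combine i j)))
  at i j = subst (λ (a , b) → P a b) (≡-sym (Fin.remQuot-combine i j))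

-- Finite tables for induced subgraphs

Row : ∀ m → (Fin m → Set) → Set
Row zero    P = ⊤
Row (suc m) P = P zero × Row m (P ∘ suc)

-- Entries for the pairs with `i` before `j` only, so that an adjacency table on seven vertices has
-- 21 entries; `triangle` restores the diagonal and the mirror half.
Triangle : ∀ m → (Fin m → Fin m → Set) → Set
Triangle zero    R = ⊤
Triangle (suc m) R = Row m (R zero ∘ suc) × Triangle m (λ i j → R (suc i) (suc j))

row : ∀ {m} {P : Fin m → Set} → Row m P → ∀ i → P i
row (p , _)  zero    = p
row (_ , ps) (suc i) = row ps i

triangle : ∀ {m} {R : Fin m → Fin m → Set} → Triangle m R →
  (∀ i → R i i) → (∀ {i j} → R i j → R j i) → ∀ i j → R i j
triangle (r , _)  Rrefl Rsym zero    zero    = Rrefl zero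
triangle (r , _)  Rrefl Rsym zero    (suc j) = row r j
triangle (r , _)  Rrefl Rsym (suc i) zero    = Rsym (row r i)
triangle (_ , rs) Rrefl Rsym (suc i) (suc j) = triangle rs (Rrefl ∘ suc) Rsym i j

-- A map that preserves adjacency and nonadjacency can identify only twins. For a pattern without
-- twins injectivity is therefore automatic, and the embeddings below never argue that vertices are
-- distinct.
TwinFree : Graph → Set
TwinFree H = ∀ i j → (∀ k → adj H i k ≡ adj H j k) → i ≡ j

twinFree? : ∀ H → Dec (TwinFree H)
twinFree? H = all? λ i → all? λ j → (all? λ k → adj H i k Bool.≟ adj H j k) →-dec (i Fin.≟ j)

<ᵇ-true : ∀ {a b} → a < b → (a <ᵇ b) ≡ true
<ᵇ-true {zero}  (s≤s _) = refl
<ᵇ-true {suc a} (s≤s p) = <ᵇ-true p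

<ᵇ-false : ∀ {a b} → b ≤ a → (a <ᵇ b) ≡ false
<ᵇ-false z≤n     = refl
<ᵇ-false (s≤s p) = <ᵇ-false p

-- The bipartite graph and its forbidden subgraphs

module Proof (G : Graph) (colour : Fin (n G) → Bool)
  (proper : ∀ u v → adj G u v ≡ true → colour u ≢ colour v)
  (d : ℕ) (d≥1 : d ≥ 1)
  (noArmchair : InducedFree G armchair) (noStirrer : InducedFree G stirrer)
  (noTripod : InducedFree G tripod) (noBiclique : InducedFree G (completeBipartite (suc d))) where

  V : Set
  V = Fin (n G)

  infix 4 _~_ _~?_

  _~_ : V → V → Set
  u ~ v = adj G u v ≡ true

  _~?_ : ∀ u v → Dec (u ~ v)
  u ~? v = adj G u v Bool.≟ true

  ~-sym : ∀ {u v} → u ~ v → v ~ u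
  ~-sym {u} {v} = trans (sym G v u)

  opposite : ∀ {u v} → u ~ v → colour v ≡ not (colour u)
  opposite e = Bool.¬-not (proper _ _ e ∘ ≡-sym)

  sameColour : ∀ {u v w} → u ~ v → v ~ w → colour u ≡ colour w
  sameColour e f = trans (≡-sym (Bool.not-involutive _)) (trans (cong not (≡-sym (opposite e))) (≡-sym (opposite f)))

  nonadjacent : ∀ {u v} → ¬ u ~ v → adj G u v ≡ false
  nonadjacent = Bool.¬-not

  sameColour-nonadjacent : ∀ {u v} → colour u ≡ colour v → adj G u v ≡ false
  sameColour-nonadjacent eq = nonadjacent λ e → proper _ _ e eq

  induce : ∀ (H : Graph) → TwinFree H → (f : Fin (n H) → V) →
    Triangle (n H) (λ i j → adj G (f i) (f j) ≡ adj H i j) → H InducedIn G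
  induce H twinFree f facts = f , injective , agree
    where
    agree : ∀ i j → adj G (f i) (f j) ≡ adj H i j
    agree = triangle facts (λ i → trans (loopless G (f i)) (≡-sym (loopless H i)))
                     (λ {i} {j} e → trans (sym G (f j) (f i)) (trans e (sym H i j)))
    injective : Injective _≡_ _≡_ f
    injective {i} {j} eq = twinFree i j λ k →
      trans (≡-sym (agree i k)) (trans (cong (λ u → adj G u (f k)) eq) (agree j k))

  -- Colours settle the pairs at even distance. What remains are the six pairs of a middle vertex
  -- and the end of another leg.
  tripod-free : ∀ {z a a′ b b′ c c′} → z ~ a → a ~ a′ → z ~ b → b ~ b′ → z ~ c → c ~ c′ →
    ¬ a ~ b′ → ¬ a ~ c′ → ¬ b ~ a′ → ¬ b ~ c′ → ¬ c ~ a′ → ¬ c ~ b′ → ⊥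
  tripod-free {z} {a} {a′} {b} {b′} {c} {c′} za aa zb bb zc cc ab ac ba bc ca cb =
    noTripod (induce tripod (toWitness {a? = twinFree? tripod} tt)
      (lookup (z ∷ a ∷ a′ ∷ b ∷ b′ ∷ c ∷ c′ ∷ []))
      ( (za , near z≡a′ , zb , near z≡b′ , zc , near z≡c′ , tt)
      , (aa , near (sameColour (~-sym za) zb) , nonadjacent ab , near (sameColour (~-sym za) zc) , nonadjacent ac , tt)
      , (nonadjacent (ba ∘ ~-sym) , near (trans (≡-sym z≡a′) z≡b′) , nonadjacent (ca ∘ ~-sym) , near (trans (≡-sym z≡a′) z≡c′) , tt)
      , (bb , near (sameColour (~-sym zb) zc) , nonadjacent bc , tt)
      , (nonadjacent (cb ∘ ~-sym) , near (trans (≡-sym z≡b′) z≡c′) , tt)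
      , (cc , tt) , tt , tt))
    where
    near = sameColour-nonadjacent
    z≡a′ = sameColour za aa
    z≡b′ = sameColour zb bb
    z≡c′ = sameColour zc cc

  -- the 4-cycle a b c e with pendants p, q, r at a, b, c
  armchair-free : ∀ {a b c e p q r} → a ~ b → b ~ c → c ~ e → e ~ a → a ~ p → b ~ q → c ~ r →
    ¬ a ~ r → ¬ c ~ p → ¬ e ~ q → ¬ q ~ p → ¬ q ~ r → ⊥
  armchair-free {a} {b} {c} {e} {p} {q} {r} ab bc ce ea ap bq cr ar cp eq qp qr =
    noArmchair (induce armchair (toWitness {a? = twinFree? armchair} tt)
      (lookup (a ∷ b ∷ c ∷ e ∷ p ∷ q ∷ r ∷ []))
      ( (ab , near (sameColour ab bc) , ~-sym ea , ap , near a≡q , nonadjacent ar , tt)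
      , (bc , near b≡e , near b≡p , bq , near (sameColour bc cr) , tt)
      , (ce , nonadjacent cp , near (sameColour (~-sym bc) bq) , cr , tt)
      , (near (sameColour ea ap) , nonadjacent eq , near (sameColour (~-sym ce) cr) , tt)
      , (nonadjacent (qp ∘ ~-sym) , near (trans (≡-sym b≡p) (sameColour bc cr)) , tt)
      , (nonadjacent qr , tt) , tt , tt))
    where
    near = sameColour-nonadjacent
    a≡q = sameColour ab bq
    b≡e = sameColour (~-sym ab) (~-sym ea)
    b≡p = sameColour (~-sym ab) ap

  -- the squares u a b v and u c e v, with a pendant p at u
  stirrer-free : ∀ {u v a b c e p} → u ~ v → u ~ a → a ~ b → b ~ v → u ~ c → c ~ e → e ~ v → u ~ p →
    ¬ a ~ e → ¬ c ~ b → ¬ p ~ b → ¬ p ~ e → ⊥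
  stirrer-free {u} {v} {a} {b} {c} {e} {p} uv ua ab bv uc ce ev up ae cb pb pe =
    noStirrer (induce stirrer (toWitness {a? = twinFree? stirrer} tt)
      (lookup (a ∷ u ∷ c ∷ b ∷ v ∷ e ∷ p ∷ []))
      ( (~-sym ua , near (sameColour (~-sym ua) uc) , ab , near (sameColour ab bv) , nonadjacent ae , near (sameColour (~-sym ua) up) , tt)
      , (uc , near (sameColour ua ab) , uv , near (sameColour uc ce) , up , tt)
      , (nonadjacent cb , near (sameColour ce ev) , ce , near (sameColour (~-sym uc) up) , tt)
      , (bv , near (trans (≡-sym (sameColour ua ab)) (sameColour uc ce)) , nonadjacent (pb ∘ ~-sym) , tt)
      , (~-sym ev , near (sameColour (~-sym uv) up) , tt)
      , (nonadjacent (pe ∘ ~-sym) , tt) , tt , tt))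
    where
    near = sameColour-nonadjacent

  -- A complete join between nonempty sets forces each of them into one colour class, which supplies
  -- the nonadjacencies inside the two sides.
  biclique-free : ∀ {P Q : V → Set} (P? : Decidable P) (Q? : Decidable Q) →
    (∀ {u v} → P u → Q v → u ~ v) → suc d ≤ count P? → suc d ≤ count Q? → ⊥
  biclique-free {P} {Q} P? Q? complete big-P big-Q
    with choose P? big-P | choose Q? big-Q
  ... | f , f-inj , Pf | g , g-inj , Qg = noBiclique (h , h-inj , h-adj)
    where
    m = suc d
    h : Fin (m + m) → V
    h i = [ f , g ]′ (splitAt m i)
    P-colour : ∀ i j → colour (f i) ≡ colour (f j)
    P-colour i j = sameColour (complete (Pf i) (Qg zero)) (~-sym (complete (Pf j) (Qg zero)))
    Q-colour : ∀ i j → colour (g i) ≡ colour (g j)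
    Q-colour i j = sameColour (~-sym (complete (Pf zero) (Qg i))) (complete (Pf zero) (Qg j))
    f≢g : ∀ i j → f i ≢ g j
    f≢g i j eq = proper _ _ (complete (Pf i) (Qg j)) (cong colour eq)
    left : ∀ i {j} → splitAt m i ≡ inj₁ j → (toℕ i <ᵇ m) ≡ true
    left i {j} eq = <ᵇ-true (subst (_< m) (trans (≡-sym (Fin.toℕ-↑ˡ j m)) (cong toℕ (Fin.splitAt⁻¹-↑ˡ {m} {m} {i} eq))) (Fin.toℕ<n j))
    right : ∀ i {j} → splitAt m i ≡ inj₂ j → (toℕ i <ᵇ m) ≡ false
    right i {j} eq = <ᵇ-false (subst (m ≤_) (trans (≡-sym (Fin.toℕ-↑ʳ m j)) (cong toℕ (Fin.splitAt⁻¹-↑ʳ {m} {m} {i} eq))) (m≤m+n m (toℕ j)))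
    h-inj : Injective _≡_ _≡_ h
    h-inj {i} {j} eq with splitAt m i in ei | splitAt m j in ej
    ... | inj₁ a | inj₁ b = trans (≡-sym (Fin.splitAt⁻¹-↑ˡ ei)) (trans (cong (_↑ˡ m) (f-inj eq)) (Fin.splitAt⁻¹-↑ˡ ej))
    ... | inj₁ a | inj₂ b = contradiction eq (f≢g a b)
    ... | inj₂ a | inj₁ b = contradiction (≡-sym eq) (f≢g b a)
    ... | inj₂ a | inj₂ b = trans (≡-sym (Fin.splitAt⁻¹-↑ʳ ei)) (trans (cong (m ↑ʳ_) (g-inj eq)) (Fin.splitAt⁻¹-↑ʳ ej))
    h-adj : ∀ i j → adj G (h i) (h j) ≡ (toℕ i <ᵇ m) xor (toℕ j <ᵇ m)
    h-adj i j with splitAt m i in ei | splitAt m j in ej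
    ... | inj₁ a | inj₁ b rewrite left i ei | left j ej   = sameColour-nonadjacent (P-colour a b)
    ... | inj₁ a | inj₂ b rewrite left i ei | right j ej  = complete (Pf a) (Qg b)
    ... | inj₂ a | inj₁ b rewrite right i ei | left j ej  = ~-sym (complete (Pf b) (Qg a))
    ... | inj₂ a | inj₂ b rewrite right i ei | right j ej = sameColour-nonadjacent (Q-colour a b)

  -- Interval models of path decompositions

  -- Each vertex is alive during a half-open interval of time, and `k` bounds the bag size, not the
  -- width. As `meets` applies to an edge in both directions, it says that the intervals of adjacent
  -- vertices intersect.
  record Intervals (P : V → Set) (k : ℕ) : Set where
    field
      decide   : Decidable P
      start    : V → ℕ
      end      : V → ℕ
      horizon  : ℕ
      nonempty : ∀ {v} → P v → start v < end v
      bounded  : ∀ {v} → P v → end v ≤ horizon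
      meets    : ∀ {u v} → P u → P v → u ~ v → start u < end v

    Active : ℕ → V → Set
    Active t v = P v × start v ≤ t × t < end v

    active? : ∀ t → Decidable (Active t)
    active? t v = decide v ×-dec (start v ≤? t) ×-dec (t <? end v)

    field
      thin : ∀ t → count (active? t) ≤ k

  intervals⇒pathwidth : ∀ {P k w} → Intervals P k → (∀ v → P v) → k ≤ suc w → PathwidthAtMost G w
  intervals⇒pathwidth {P} I all k≤ = record
    { r = horizon
    ; bag = λ i → tabulate (does ∘ active? (toℕ i))
    ; covers-vertices = λ v → case at (s<h v) of λ (i , i≡) →
        i , ∈-tabulate⁺ (active? (toℕ i)) (subst (λ t → Active t v) (≡-sym i≡) (all v , ≤-refl , nonempty (all v)))
    ; covers-edges = edges
    ; interval = λ v i j k i≤j j≤k vi vk →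
        case ∈-tabulate⁻ (active? (toℕ i)) vi , ∈-tabulate⁻ (active? (toℕ k)) vk of λ
          ((p , s≤ , _) , (_ , _ , <e)) →
            ∈-tabulate⁺ (active? (toℕ j)) (p , ≤-trans s≤ i≤j , ≤-<-trans j≤k <e) }
    , λ i → ≤-trans (∣tabulate∣≤count (active? (toℕ i))) (≤-trans (thin (toℕ i)) k≤)
    where
    open Intervals I
    s<h : ∀ v → start v < horizon
    s<h v = <-≤-trans (nonempty (all v)) (bounded (all v))
    at : ∀ {t} → t < horizon → ∃ λ i → toℕ i ≡ t
    at t<h = fromℕ< t<h , Fin.toℕ-fromℕ< t<h
    edges : ∀ u v → adj G u v ≡ true → ∃ λ i → _ × _
    -- The later of the two starts is a time at which both ends are active.
    edges u v e with ≤-total (start u) (start v)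
    ... | inj₁ le = case at (s<h v) of λ (i , i≡) → i
      , ∈-tabulate⁺ (active? (toℕ i)) (subst (λ t → Active t u) (≡-sym i≡) (all u , le , meets (all v) (all u) (~-sym e)))
      , ∈-tabulate⁺ (active? (toℕ i)) (subst (λ t → Active t v) (≡-sym i≡) (all v , ≤-refl , nonempty (all v)))
    ... | inj₂ ge = case at (s<h u) of λ (i , i≡) → i
      , ∈-tabulate⁺ (active? (toℕ i)) (subst (λ t → Active t u) (≡-sym i≡) (all u , ≤-refl , nonempty (all u)))
      , ∈-tabulate⁺ (active? (toℕ i)) (subst (λ t → Active t v) (≡-sym i≡) (all v , ge , meets (all u) (all v) e))

  -- The second model runs after the first, shifted by its horizon; a vertex in both sets keeps its
  -- interval from the first.
  concatenate : ∀ {P Q R k} → Intervals P k → Intervals Q k → Decidable R →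
    (∀ {v} → R v → P v ⊎ Q v) → (∀ {u v} → P u → Q v → ¬ u ~ v) → Intervals R k
  concatenate {P} {Q} {R} {k} I J R? split separated = record
    { decide = R? ; start = start′ ; end = end′ ; horizon = I.horizon + J.horizon
    ; nonempty = nonempty′ ; bounded = bounded′ ; meets = meets′ ; thin = thin′ }
    where
    module I = Intervals I
    module J = Intervals J
    first : {A : V → Set} → (∀ v → Dec (A v)) → (V → ℕ) → (V → ℕ) → V → ℕ
    first A? f g v with A? v
    ... | yes _ = f v
    ... | no _  = I.horizon + g v
    start′ end′ : V → ℕ
    start′ = first I.decide I.start J.start
    end′   = first I.decide I.end J.end
    inQ : ∀ {v} → R v → ¬ P v → Q v
    inQ r ¬p = [ (λ p → contradiction p ¬p) , id ]′ (split r)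
    nonempty′ : ∀ {v} → R v → start′ v < end′ v
    nonempty′ {v} r with I.decide v
    ... | yes p = I.nonempty p
    ... | no ¬p = +-monoʳ-< I.horizon (J.nonempty (inQ r ¬p))
    bounded′ : ∀ {v} → R v → end′ v ≤ I.horizon + J.horizon
    bounded′ {v} r with I.decide v
    ... | yes p = ≤-trans (I.bounded p) (m≤m+n _ _)
    ... | no ¬p = +-monoʳ-≤ I.horizon (J.bounded (inQ r ¬p))
    meets′ : ∀ {u v} → R u → R v → u ~ v → start′ u < end′ v
    meets′ {u} {v} r s e with I.decide u | I.decide v
    ... | yes p | yes q = I.meets p q e
    ... | yes p | no ¬q = contradiction e (separated p (inQ s ¬q))
    ... | no ¬p | yes q = contradiction (~-sym e) (separated q (inQ r ¬p))
    ... | no ¬p | no ¬q = +-monoʳ-< I.horizon (J.meets (inQ r ¬p) (inQ s ¬q) e)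
    thin′ : ∀ t → count (λ v → R? v ×-dec (start′ v ≤? t) ×-dec (t <? end′ v)) ≤ k
    thin′ t with t <? I.horizon
    ... | yes t<h = ≤-trans (count-mono _ (I.active? t) early) (I.thin t)
      where
      early : ∀ v → R v × start′ v ≤ t × t < end′ v → I.Active t v
      early v (r , s≤ , <e) with I.decide v
      ... | yes p = p , s≤ , <e
      ... | no ¬p = contradiction (≤-trans (m≤m+n _ _) s≤) (<⇒≱ t<h)
    ... | no t≮h = ≤-trans (count-mono _ (J.active? (t ∸ I.horizon)) late) (J.thin (t ∸ I.horizon))
      where
      h≤t : I.horizon ≤ t
      h≤t = ≮⇒≥ t≮h
      late : ∀ v → R v × start′ v ≤ t × t < end′ v → J.Active (t ∸ I.horizon) v
      late v (r , s≤ , <e) with I.decide v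
      ... | yes p = contradiction (<-≤-trans <e (I.bounded p)) t≮h
      ... | no ¬p = inQ r ¬p
                  , +-cancelˡ-≤ I.horizon _ _ (≤-trans s≤ (≤-reflexive (≡-sym (m+[n∸m]≡n h≤t))))
                  , +-cancelˡ-< I.horizon _ _ (≤-<-trans (≤-reflexive (m+[n∸m]≡n h≤t)) <e)

  addToAll : ∀ {P S R k j} → Intervals P k → (S? : Decidable S) → count S? ≤ j → Decidable R →
    (∀ {v} → R v → P v ⊎ S v) → Intervals R (k + j)
  addToAll {P} {S} {R} {k} {j} I S? small R? split = record
    { decide = R? ; start = start′ ; end = end′ ; horizon = suc I.horizon
    ; nonempty = nonempty′ ; bounded = bounded′ ; meets = meets′ ; thin = thin′ }
    where
    module I = Intervals I
    start′ end′ : V → ℕ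
    start′ v with S? v
    ... | yes _ = 0
    ... | no _  = I.start v
    end′ v with S? v
    -- One unit past the old horizon keeps this interval nonempty even when that horizon is 0.
    ... | yes _ = suc I.horizon
    ... | no _  = I.end v
    inP : ∀ {v} → R v → ¬ S v → P v
    inP r ¬s = [ id , (λ s → contradiction s ¬s) ]′ (split r)
    nonempty′ : ∀ {v} → R v → start′ v < end′ v
    nonempty′ {v} r with S? v
    ... | yes _ = s≤s z≤n
    ... | no ¬s = I.nonempty (inP r ¬s)
    bounded′ : ∀ {v} → R v → end′ v ≤ suc I.horizon
    bounded′ {v} r with S? v
    ... | yes _ = ≤-refl
    ... | no ¬s = m≤n⇒m≤1+n (I.bounded (inP r ¬s))
    meets′ : ∀ {u v} → R u → R v → u ~ v → start′ u < end′ v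
    meets′ {u} {v} r q e with S? u | S? v
    ... | yes _ | yes _ = s≤s z≤n
    ... | yes _ | no ¬s = ≤-<-trans z≤n (I.nonempty (inP q ¬s))
    ... | no ¬s | yes _ = m≤n⇒m≤1+n (<-≤-trans (I.nonempty (inP r ¬s)) (I.bounded (inP r ¬s)))
    ... | no ¬s | no ¬t = I.meets (inP r ¬s) (inP q ¬t) e
    thin′ : ∀ t → count (λ v → R? v ×-dec (start′ v ≤? t) ×-dec (t <? end′ v)) ≤ k + j
    thin′ t = ≤-trans (count-∪ _ (I.active? t) S? cases) (+-mono-≤ (I.thin t) small)
      where
      cases : ∀ v → R v × start′ v ≤ t × t < end′ v → I.Active t v ⊎ S v
      cases v (r , s≤ , <e) with S? v
      ... | yes s = inj₂ s
      ... | no ¬s = inj₁ (inP r ¬s , s≤ , <e)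

  -- Bag v holds v and the earlier vertices with a neighbour at or after v.
  module FromOrder {P : V → Set} (P? : Decidable P)
    (_≺_ : V → V → Set) (_≺?_ : ∀ u v → Dec (u ≺ v))
    (≺-irrefl : ∀ {u} → ¬ u ≺ u)
    (≺-trans : ∀ {u v w} → P u → P v → P w → u ≺ v → v ≺ w → u ≺ w)
    (≺-tri : ∀ {u v} → P u → P v → u ≺ v ⊎ u ≡ v ⊎ v ≺ u) where

    Closed : V → V → Set
    Closed u w = P w × (w ≡ u ⊎ u ~ w)

    closed? : ∀ u w → Dec (Closed u w)
    closed? u w = P? w ×-dec ((w Fin.≟ u) ⊎-dec (u ~? w))

    Bag : V → V → Set
    Bag v u = P u × ¬ v ≺ u × ∃ λ w → Closed u w × ¬ w ≺ v

    bag? : ∀ v → Decidable (Bag v)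
    bag? v u = P? u ×-dec ¬? (v ≺? u) ×-dec any? (λ w → closed? u w ×-dec ¬? (w ≺? v))

    module _ {k : ℕ} (small : ∀ {v} → P v → count (bag? v) ≤ k) where

      private
        ≮-≺-trans : ∀ {u v w} → P u → P v → P w → ¬ u ≺ v → u ≺ w → v ≺ w
        ≮-≺-trans pu pv pw u⊀v u≺w with ≺-tri pu pv
        ... | inj₁ u≺v         = contradiction u≺v u⊀v
        ... | inj₂ (inj₁ refl) = u≺w
        ... | inj₂ (inj₂ v≺u)  = ≺-trans pv pu pw v≺u u≺w

        Below : V → V → Set
        Below v x = P x × x ≺ v
        below? : ∀ v → Decidable (Below v)
        below? v x = P? x ×-dec (x ≺? v)
        Reached : V → V → Set
        Reached v x = P x × ∃ λ w → Closed v w × ¬ w ≺ x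
        reached? : ∀ v → Decidable (Reached v)
        reached? v x = P? x ×-dec any? (λ w → closed? v w ×-dec ¬? (w ≺? x))

        -- `rank` is the position in the order, and `end′` is one more than the position of the last
        -- closed neighbour, both expressed as counts.
        rank end′ : V → ℕ
        rank v = count (below? v)
        end′ v = count (reached? v)

        rank<end : ∀ {u v} → P u → Closed v u → rank u < end′ v
        rank<end {u} pu vu = count-strict (below? u) (reached? _)
          (λ x (px , x≺u) → px , u , vu , λ u≺x → ≺-irrefl (≺-trans px pu px x≺u u≺x))
          u (pu , u , vu , ≺-irrefl) (≺-irrefl ∘ proj₂)

        live? : ∀ t → Decidable (λ v → P v × rank v ≤ t × t < end′ v)
        live? t v = P? v ×-dec (rank v ≤? t) ×-dec (t <? end′ v)

        thin′ : ∀ t → count (live? t) ≤ k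
        thin′ t with any? (λ v → P? v ×-dec (rank v ≤? t))
        ... | no none = ≤-trans (≤-reflexive (count-none (live? t) λ v (p , r≤ , _) → none (v , p , r≤))) z≤n
        -- A least element for this relation is a last one for `≺`: `v` is the last vertex of rank
        -- at most `t`, and everything alive at time `t` lies in its bag.
        ... | yes some with least (λ v → P? v ×-dec (rank v ≤? t)) (λ i j → ¬ i ≺ j)
                              (λ (pi , _) (pj , _) → case ≺-tri pi pj of λ
                                 { (inj₁ i≺j) → inj₂ λ j≺i → ≺-irrefl (≺-trans pi pj pi i≺j j≺i)
                                 ; (inj₂ (inj₁ refl)) → inj₁ ≺-irrefl
                                 ; (inj₂ (inj₂ j≺i)) → inj₁ λ i≺j → ≺-irrefl (≺-trans pi pj pi i≺j j≺i) })
                              (λ (pi , _) (pj , _) (pk , _) i⊀j j⊀k i≺k → j⊀k (≮-≺-trans pi pj pk i⊀j i≺k)) some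
        ... | v , (pv , rv≤t) , last = ≤-trans (count-mono (live? t) (bag? v) inBag) (small pv)
          where
          inBag : ∀ u → P u × rank u ≤ t × t < end′ u → Bag v u
          inBag u (pu , ru≤t , t<eu) with any? (λ w → closed? u w ×-dec ¬? (w ≺? v))
          ... | yes hit = pu , last u (pu , ru≤t) , hit
          ... | no miss = contradiction (<-≤-trans t<eu (≤-trans (count-mono (reached? u) (below? v) before) rv≤t)) (n≮n t)
            where
            before : ∀ x → Reached u x → Below v x
            before x (px , w , uw , w⊀x) = px , ≮-≺-trans (proj₁ uw) px pv w⊀x
              (decidable-stable (w ≺? v) λ w⊀v → miss (w , uw , w⊀v))

      orderIntervals : Intervals P k
      orderIntervals = record
        { decide = P? ; start = rank ; end = end′ ; horizon = n G
        ; nonempty = λ p → rank<end p (p , inj₁ refl)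
        ; bounded = λ {v} _ → count≤m (reached? v)
        ; meets = λ pu pv e → rank<end pu (pu , inj₂ (~-sym e))
        ; thin = thin′ }

  -- Strong orderings

  HasNeighbour : (V → Set) → V → Set
  HasNeighbour W u = ∃ λ v → W v × u ~ v

  sameColour-pair : ∀ {u v u′ v′} → colour v ≡ colour v′ → u ~ v → u′ ~ v′ → colour u ≡ colour u′
  sameColour-pair eq e f = trans (opposite (~-sym e)) (trans (cong not eq) (≡-sym (opposite (~-sym f))))

  ≢-≢⇒≡ : ∀ {a b c : Bool} → a ≢ b → c ≢ b → a ≡ c
  ≢-≢⇒≡ p q = trans (Bool.¬-not p) (≡-sym (Bool.¬-not q))

  -- `strong` is the strong ordering known from bipartite permutation graphs, with one key serving
  -- both colour classes: two crossing edges span a complete bipartite graph.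
  module StrongOrder {W : V → Set} (W? : Decidable W)
    (key : V → ℕ) (key-injective : ∀ {u v} → key u ≡ key v → u ≡ v)
    (strong : ∀ {u u′ v v′} → W u → W u′ → W v → W v′ → colour u ≡ colour u′ →
      key u ≤ key u′ → key v ≤ key v′ → u ~ v′ → u′ ~ v → u ~ v × u′ ~ v′)
    (isolated-first : ∀ {u v} → W u → W v → key u ≤ key v → HasNeighbour W u → HasNeighbour W v) where

    -- The boundary, in the colour of `u`, of a cut placed after `u` in one class and before `v` in
    -- the other.
    Front : V → V → V → Set
    Front u v x = W x × colour x ≡ colour u × key x ≤ key u × ∃ λ y → W y × key v ≤ key y × x ~ y

    front? : ∀ u v → Decidable (Front u v)
    front? u v x = W? x ×-dec (colour x Bool.≟ colour u) ×-dec (key x ≤? key u) ×-dec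
      any? (λ y → W? y ×-dec (key v ≤? key y) ×-dec (x ~? y))

    front : V → V → ℕ
    front u v = count (front? u v)

    front-mono : ∀ {u u′ v v′} → colour u ≡ colour u′ → key u ≤ key u′ → key v′ ≤ key v → front u v ≤ front u′ v′
    front-mono eq u≤ v≥ = count-mono (front? _ _) (front? _ _)
      λ x (wx , cx , x≤ , y , wy , y≥ , e) → wx , trans cx eq , ≤-trans x≤ u≤ , y , wy , ≤-trans v≥ y≥ , e

    -- a strong ordering joins opposite fronts completely
    blocked : ∀ {u v} → colour u ≢ colour v → ¬ front u v ≤ d → front v u ≤ d
    blocked {u} {v} u≢v big with front v u ≤? d
    ... | yes small = small
    ... | no big′ = ⊥-elim (biclique-free (front? u v) (front? v u) joined (≰⇒> big) (≰⇒> big′))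
      where
      joined : ∀ {x z} → Front u v x → Front v u z → x ~ z
      joined (wx , cx , x≤ , y , wy , y≥ , xy) (wz , cz , z≤ , t , wt , t≥ , zt) =
        proj₁ (strong wx wt wz wy (trans cx (≢-≢⇒≡ u≢v λ t≡v → proper _ _ zt (trans cz (≡-sym t≡v))))
          (≤-trans x≤ t≥) (≤-trans z≤ y≥) xy (~-sym zt))

    -- The colour classes are merged so that, of two oppositely coloured vertices, the earlier one has a small front.
    Precedes : Bool → Bool → V → V → Set
    Precedes false true  u v = front u v ≤ d
    Precedes true  false u v = ¬ front v u ≤ d
    Precedes false false u v = key u < key v
    Precedes true  true  u v = key u < key v

    precedes? : ∀ a b u v → Dec (Precedes a b u v)
    precedes? false true  u v = front u v ≤? d
    precedes? true  false u v = ¬? (front v u ≤? d)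
    precedes? false false u v = key u <? key v
    precedes? true  true  u v = key u <? key v

    infix 4 _≺_

    _≺_ : V → V → Set
    u ≺ v = Precedes (colour u) (colour v) u v

    same⁻ : ∀ a b {u v} → a ≡ b → Precedes a b u v → key u < key v
    same⁻ false false _ p = p
    same⁻ true  true  _ p = p

    same⁺ : ∀ a b {u v} → a ≡ b → key u < key v → Precedes a b u v
    same⁺ false false _ p = p
    same⁺ true  true  _ p = p

    -- `Precedes` uses one front for one direction and its negation for the other, which makes it
    -- total and asymmetric at once. Here `blocked` turns the negation back into a bound.
    cross-front : ∀ a b {u v} → colour u ≢ colour v → a ≢ b → Precedes a b u v → front u v ≤ d
    cross-front false true  u≢v a≢b p = p
    cross-front true  false u≢v a≢b p = blocked (u≢v ∘ ≡-sym) p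
    cross-front false false u≢v a≢b p = contradiction refl a≢b
    cross-front true  true  u≢v a≢b p = contradiction refl a≢b

    lowerˡ : ∀ a a′ b {u u′ v} → a ≡ a′ → a ≢ b → colour u ≡ colour u′ → key u ≤ key u′ →
      Precedes a′ b u′ v → Precedes a b u v
    lowerˡ false _ true  refl _ eq u≤ p = ≤-trans (front-mono eq u≤ ≤-refl) p
    lowerˡ true  _ false refl _ eq u≤ p = p ∘ ≤-trans (front-mono refl ≤-refl u≤)
    lowerˡ false _ false refl a≢b     = contradiction refl a≢b
    lowerˡ true  _ true  refl a≢b     = contradiction refl a≢b

    raiseʳ : ∀ a b b′ {u v v′} → b ≡ b′ → a ≢ b → colour v ≡ colour v′ → key v ≤ key v′ →
      Precedes a b u v → Precedes a b′ u v′
    raiseʳ false true  _ refl _ eq v≤ p = ≤-trans (front-mono refl ≤-refl v≤) p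
    raiseʳ true  false _ refl _ eq v≤ p = p ∘ ≤-trans (front-mono eq v≤ ≤-refl)
    raiseʳ false false _ refl a≢b     = contradiction refl a≢b
    raiseʳ true  true  _ refl a≢b     = contradiction refl a≢b

    cross-asym : ∀ a b {u v} → a ≢ b → Precedes a b u v → ¬ Precedes b a v u
    cross-asym false true  _   p q = q p
    cross-asym true  false _   p q = p q
    cross-asym false false a≢b     = contradiction refl a≢b
    cross-asym true  true  a≢b     = contradiction refl a≢b

    cross-total : ∀ a b {u v} → a ≢ b → Precedes a b u v ⊎ Precedes b a v u
    cross-total false true {u} {v} _ with front u v ≤? d
    ... | yes p = inj₁ p
    ... | no ¬p = inj₂ ¬p
    cross-total true false {u} {v} _ with front v u ≤? d
    ... | yes p = inj₂ p
    ... | no ¬p = inj₁ ¬p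
    cross-total false false a≢b = contradiction refl a≢b
    cross-total true  true  a≢b = contradiction refl a≢b

    ≺-irrefl : ∀ {u} → ¬ u ≺ u
    ≺-irrefl {u} p = n≮n _ (same⁻ (colour u) (colour u) refl p)

    ≺-trans : ∀ {u v w} → u ≺ v → v ≺ w → u ≺ w
    ≺-trans {u} {v} {w} p q with colour u Bool.≟ colour v | colour v Bool.≟ colour w
    ... | yes e | yes f = same⁺ _ _ (trans e f) (<-trans (same⁻ _ _ e p) (same⁻ _ _ f q))
    ... | yes e | no ¬f = lowerˡ _ _ _ e (λ g → ¬f (trans (≡-sym e) g)) e (<⇒≤ (same⁻ _ _ e p)) q
    ... | no ¬e | yes f = raiseʳ _ _ _ f ¬e f (<⇒≤ (same⁻ _ _ f q)) p
    -- If `w` had a key at most that of `u`, then `u ≺ v` would descend to `w ≺ v`, against `v ≺ w`.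
    ... | no ¬e | no ¬f = same⁺ _ _ eq (≰⇒> λ w≤u →
        cross-asym _ _ (¬f ∘ ≡-sym) (lowerˡ _ _ _ (≡-sym eq) (¬f ∘ ≡-sym) (≡-sym eq) w≤u p) q)
      where
      eq : colour u ≡ colour w
      eq = ≢-≢⇒≡ ¬e (¬f ∘ ≡-sym)

    ≺-tri : ∀ {u v} → u ≺ v ⊎ u ≡ v ⊎ v ≺ u
    ≺-tri {u} {v} with colour u Bool.≟ colour v
    ... | no ¬e = case cross-total _ _ ¬e of λ { (inj₁ p) → inj₁ p ; (inj₂ p) → inj₂ (inj₂ p) }
    ... | yes e with <-cmp (key u) (key v)
    ...   | tri< lt _ _ = inj₁ (same⁺ _ _ e lt)
    ...   | tri≈ _ eq _ = inj₂ (inj₁ (key-injective eq))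
    ...   | tri> _ _ gt = inj₂ (inj₂ (same⁺ _ _ (≡-sym e) gt))

    ⊀⇒≺ : ∀ {u v} → u ≢ v → ¬ u ≺ v → v ≺ u
    ⊀⇒≺ u≢v u⊀v = case ≺-tri of λ { (inj₁ p) → contradiction p u⊀v
      ; (inj₂ (inj₁ eq)) → contradiction eq u≢v ; (inj₂ (inj₂ p)) → p }

    open FromOrder W? _≺_ (λ u v → precedes? (colour u) (colour v) u v)
      ≺-irrefl (λ _ _ _ → ≺-trans) (λ _ _ → ≺-tri)

    private
      Near Far : V → V → Set
      Near v u = W u × colour u ≡ colour v × key u ≤ key v × ∃ λ w → W w × u ~ w × v ≺ w
      Far v u = W u × colour u ≢ colour v × u ≺ v × ∃ λ w → W w × u ~ w × key v ≤ key w

      near? : ∀ v → Decidable (Near v)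
      near? v u = W? u ×-dec (colour u Bool.≟ colour v) ×-dec (key u ≤? key v) ×-dec
        any? (λ w → W? w ×-dec (u ~? w) ×-dec precedes? (colour v) (colour w) v w)
      far? : ∀ v → Decidable (Far v)
      far? v u = W? u ×-dec ¬? (colour u Bool.≟ colour v) ×-dec precedes? (colour u) (colour v) u v ×-dec
        any? (λ w → W? w ×-dec (u ~? w) ×-dec (key v ≤? key w))

      bag-split : ∀ {v u} → Bag v u → (u ≡ v ⊎ Near v u) ⊎ Far v u
      bag-split {v} {u} (wu , v⊀u , w , (ww , inj₁ refl) , u⊀v) with ≺-tri {u} {v}
      ... | inj₁ p        = contradiction p u⊀v
      ... | inj₂ (inj₁ e) = inj₁ (inj₁ e)
      ... | inj₂ (inj₂ p) = contradiction p v⊀u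
      bag-split {v} {u} (wu , v⊀u , w , (ww , inj₂ uw) , w⊀v) with colour u Bool.≟ colour v
      ... | yes e = inj₁ (inj₂ (wu , e , ≮⇒≥ (v⊀u ∘ same⁺ _ _ (≡-sym e)) , w , ww , uw
                  , ⊀⇒≺ (λ { refl → proper _ _ uw e }) w⊀v))
      ... | no ¬e = inj₂ (wu , ¬e , ⊀⇒≺ (¬e ∘ cong colour ∘ ≡-sym) v⊀u , w , ww , uw
                  , ≮⇒≥ (w⊀v ∘ same⁺ _ _ (≢-≢⇒≡ (proper _ _ uw ∘ ≡-sym) (¬e ∘ ≡-sym))))

      -- Let `b` be the first vertex of the other colour after `v`. The later neighbours of near
      -- vertices lie at or beyond `b`, so these vertices belong to the front of `v` against `b`,
      -- which is small because `v ≺ b`. For `far-small`, `b` is the last vertex of the other colour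
      -- before `v`.
      near-small : ∀ v → count (near? v) ≤ d
      near-small v with any? (λ b → W? b ×-dec ¬? (colour v Bool.≟ colour b) ×-dec precedes? (colour v) (colour b) v b)
      ... | no none = ≤-trans (≤-reflexive (count-none (near? v)
              λ u (_ , e , _ , w , ww , uw , v≺w) → none (w , ww , (λ f → proper _ _ uw (trans e f)) , v≺w))) z≤n
      ... | yes some with argmin (λ b → W? b ×-dec ¬? (colour v Bool.≟ colour b) ×-dec precedes? (colour v) (colour b) v b) key some
      ...   | b , (_ , v≢b , v≺b) , min = ≤-trans (count-mono (near? v) (front? v b)
              λ u (wu , e , u≤ , w , ww , uw , v≺w) →
                wu , e , u≤ , w , ww , min w (ww , (λ f → proper _ _ uw (trans e f)) , v≺w) , uw)
              (cross-front _ _ v≢b v≢b v≺b)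

      far-small : ∀ v → count (far? v) ≤ d
      far-small v with any? (λ b → W? b ×-dec ¬? (colour b Bool.≟ colour v) ×-dec precedes? (colour b) (colour v) b v)
      ... | no none = ≤-trans (≤-reflexive (count-none (far? v)
              λ u (wu , u≢v , u≺v , _) → none (u , wu , u≢v , u≺v))) z≤n
      ... | yes some with argmax (λ b → W? b ×-dec ¬? (colour b Bool.≟ colour v) ×-dec precedes? (colour b) (colour v) b v) key some
      ...   | b , (_ , b≢v , b≺v) , max = ≤-trans (count-mono (far? v) (front? b v)
              λ u (wu , u≢v , u≺v , w , ww , uw , v≤w) →
                wu , ≢-≢⇒≡ u≢v b≢v , max u (wu , u≢v , u≺v) , w , ww , v≤w , uw)
              (cross-front _ _ b≢v b≢v b≺v)

      -- This saves the one vertex by which a bag could exceed 2d: `v` is already counted whenever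
      -- some vertex is near. Either the neighbour `b` of `v` comes after `v`, or the edges `u w`
      -- and `v b` cross or share an end, and the strong ordering gives the edge `v w`.
      near-self : ∀ {v u} → W v → Near v u → Near v v
      near-self {v} wv (wu , e , u≤v , w , ww , uw , v≺w)
        with isolated-first wu wv u≤v (w , ww , uw)
      ... | b , wb , vb with ≺-tri {v} {b}
      ...   | inj₁ v≺b         = wv , refl , ≤-refl , b , wb , vb , v≺b
      ...   | inj₂ (inj₁ refl) = contradiction refl (proper _ _ vb)
      ...   | inj₂ (inj₂ b≺v)  = wv , refl , ≤-refl , w , ww
              , proj₂ (strong wu wv wb ww e u≤v (<⇒≤ (same⁻ _ _ (sameColour-pair (≡-sym e) (~-sym vb) (~-sym uw)) (≺-trans b≺v v≺w))) uw vb)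
              , v≺w

      bag-small : ∀ {v} → W v → count (bag? v) ≤ d + d
      bag-small {v} wv with any? (near? v)
      ... | yes (u , nu) = ≤-trans (count-∪ (bag? v) (near? v) (far? v)
              λ x bx → case bag-split bx of λ { (inj₁ (inj₁ refl)) → inj₁ (near-self wv nu)
                                              ; (inj₁ (inj₂ p)) → inj₁ p ; (inj₂ q) → inj₂ q })
              (+-mono-≤ (near-small v) (far-small v))
      -- With nothing near, the bag is `v` and at most `d` far vertices; `d≥1` makes this fit.
      ... | no none = ≤-trans (count-∪ (bag? v) (Fin._≟ v) (far? v)
              λ x bx → case bag-split bx of λ { (inj₁ (inj₁ e)) → inj₁ e
                                              ; (inj₁ (inj₂ p)) → contradiction (x , p) none ; (inj₂ q) → inj₂ q })
              (+-mono-≤ (≤-trans (count-unique (Fin._≟ v) λ i j e f → trans e (≡-sym f)) d≥1) (far-small v))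

    strongIntervals : Intervals W (d + d)
    strongIntervals = orderIntervals bag-small

  -- Layerings

  record Layering (W : V → Set) : Set where
    field
      level       : V → ℕ
      monochrome  : ∀ {u v} → W u → W v → level u ≡ level v → colour u ≡ colour v
      consecutive : ∀ {u v} → W u → W v → u ~ v → level v ≡ suc (level u) ⊎ level u ≡ suc (level v)
      chain       : ∀ {u u′ v v′} → W u → W u′ → W v → W v′ → level u ≡ level u′ →
        level v ≡ suc (level u) → level v′ ≡ suc (level u′) → u ~ v → u′ ~ v′ → u ~ v′ ⊎ u′ ~ v
      -- so that a level can be sorted by shrinking lower and growing upper neighbourhoods
      compatible  : ∀ {u u′ p w} → W u → W u′ → W p → W w → level u ≡ level u′ →
        level u ≡ suc (level p) → level w ≡ suc (level u) → u ~ p → u ~ w → ¬ u′ ~ p → u′ ~ w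

  lexicographic : ∀ {N i j} a b → j < N → a * N + i ≤ b * N + j → a < b ⊎ a ≡ b × i ≤ j
  lexicographic {N} {i} {j} a b j<N le with <-cmp a b
  ... | tri< a<b _ _  = inj₁ a<b
  ... | tri≈ _ refl _ = inj₂ (refl , +-cancelˡ-≤ (a * N) i j le)
  ... | tri> _ _ b<a  = contradiction le (<⇒≱ (begin-strict
      b * N + j  <⟨ +-monoʳ-< (b * N) j<N ⟩
      b * N + N  ≡⟨ +-comm (b * N) N ⟩
      suc b * N  ≤⟨ *-monoˡ-≤ N b<a ⟩
      a * N      ≤⟨ m≤m+n (a * N) i ⟩
      a * N + i  ∎))
    where open ≤-Reasoning

  module _ {W : V → Set} (W? : Decidable W) (L : Layering W) where

    open Layering L

    private
      N : ℕ
      N = n G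

      Up Down : V → V → Set
      Up   u x = W x × u ~ x × level x ≡ suc (level u)
      Down u x = W x × u ~ x × level u ≡ suc (level x)

      up? : ∀ u → Decidable (Up u)
      up? u x = W? x ×-dec (u ~? x) ×-dec (level x ℕ.≟ suc (level u))
      down? : ∀ u → Decidable (Down u)
      down? u x = W? x ×-dec (u ~? x) ×-dec (level u ℕ.≟ suc (level x))

      -- `κ` grows with the upper neighbourhood and falls with the lower one. As both are nested and
      -- compatible along a level, this single number sorts by both. The subtraction never
      -- truncates, since `downs` is at most `N`.
      ups downs κ : V → ℕ
      ups u   = count (up? u)
      downs u = count (down? u)
      κ u     = ups u + (N ∸ downs u)

      Lower : V → V → Set
      Lower u u′ = (∀ {p} → Down u′ p → u ~ p) × (∀ {w} → Up u w → u′ ~ w)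

      -- If `u` missed some `p` below `u′`, the chain condition would make its lower neighbourhood
      -- strictly smaller and compatibility its upper one at least as large, so `κ u` would exceed
      -- `κ u′`. The other half is dual.
      κ-lower : ∀ {u u′} → W u → W u′ → level u ≡ level u′ → κ u ≤ κ u′ → Lower u u′
      κ-lower {u} {u′} wu wu′ l le = lower , upper
        where
        lower : ∀ {p} → Down u′ p → u ~ p
        lower {p} (wp , u′p , lp) = decidable-stable (u ~? p) λ u≁p → contradiction le (<⇒≱ (+-mono-≤-<
          (count-mono (up? u′) (up? u) λ w (ww , u′w , lw) →
            ww , compatible wu′ wu wp ww (≡-sym l) lp lw u′p u′w u≁p , trans lw (cong suc (≡-sym l)))
          (∸-monoʳ-< (count-strict (down? u) (down? u′)
            (λ q (wq , uq , lq) → wq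
              , [ ~-sym , (λ pu → contradiction (~-sym pu) u≁p) ]′
                  (chain wq wp wu wu′ (suc-injective (trans (≡-sym lq) (trans l lp))) lq lp (~-sym uq) (~-sym u′p))
              , trans (≡-sym l) lq)
            p (wp , u′p , lp) (u≁p ∘ proj₁ ∘ proj₂)) (count≤m (down? u′)))))
        upper : ∀ {w} → Up u w → u′ ~ w
        upper {w} (ww , uw , lw) = decidable-stable (u′ ~? w) λ u′≁w → contradiction le (<⇒≱ (+-mono-<-≤
          (count-strict (up? u′) (up? u)
            (λ x (wx , u′x , lx) → wx
              , [ id , (λ u′w → contradiction u′w u′≁w) ]′ (chain wu wu′ ww wx l lw lx uw u′x)
              , trans lx (cong suc (≡-sym l)))
            w (ww , uw , lw) (u′≁w ∘ proj₁ ∘ proj₂))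
          (∸-monoʳ-≤ N (count-mono (down? u) (down? u′) λ p (wp , up , lp) → wp
              , decidable-stable (u′ ~? p) (λ u′≁p → u′≁w (compatible wu wu′ wp ww l lp lw up uw u′≁p))
              , trans (≡-sym l) lp))))

      pos : V → ℕ
      -- The factor exceeds every value of `κ`, so levels are compared first.
      pos u = level u * suc (N + N) + κ u

      pos-≤ : ∀ {u u′} → W u → W u′ → pos u ≤ pos u′ → level u < level u′ ⊎ level u ≡ level u′ × Lower u u′
      pos-≤ {u} {u′} wu wu′ le with lexicographic (level u) (level u′)
                                    (s≤s (+-mono-≤ (count≤m (up? u′)) (m∸n≤m N (downs u′)))) le
      ... | inj₁ lt        = inj₁ lt
      ... | inj₂ (l , κ≤)  = inj₂ (l , κ-lower wu wu′ l κ≤)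

      ≤-level : ∀ {u u′} → level u < level u′ ⊎ level u ≡ level u′ × Lower u u′ → level u ≤ level u′
      ≤-level (inj₁ lt)      = <⇒≤ lt
      ≤-level (inj₂ (l , _)) = ≤-reflexive l

      -- Where a pair shares a level, `Lower` moves the edges. The other combinations contradict the
      -- order of the levels, the last one by putting `u` and `v` on one level although their
      -- colours differ.
      strong-pos : ∀ {u u′ v v′} → W u → W u′ → W v → W v′ → colour u ≡ colour u′ →
        pos u ≤ pos u′ → pos v ≤ pos v′ → u ~ v′ → u′ ~ v → u ~ v × u′ ~ v′
      strong-pos {u} {u′} {v} {v′} wu wu′ wv wv′ c pu pv uv′ u′v
        with pos-≤ wu wu′ pu | pos-≤ wv wv′ pv | consecutive wu wv′ uv′ | consecutive wu′ wv u′v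
      ... | inj₂ (l , lo , hi) | inj₂ (m , lo′ , hi′) | inj₁ a | inj₁ b =
              ~-sym (lo′ (wu , ~-sym uv′ , a)) , hi (wv′ , uv′ , a)
      ... | inj₂ (l , _) | inj₁ m | inj₁ a | inj₁ b =
              contradiction (trans b (trans (cong suc (≡-sym l)) (≡-sym a))) (<⇒≢ m)
      ... | inj₂ (l , lo , hi) | inj₂ (m , lo′ , hi′) | inj₂ a | inj₂ b =
              lo (wv , u′v , b) , ~-sym (hi′ (wu′ , ~-sym u′v , b))
      ... | inj₂ (l , _) | inj₁ m | inj₂ a | inj₂ b =
              contradiction (suc-injective (trans (≡-sym b) (trans (≡-sym l) a))) (<⇒≢ m)
      ... | inj₂ (l , lo , hi) | _ | inj₁ a | inj₂ b = lo (wv , u′v , b) , hi (wv′ , uv′ , a)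
      ... | inj₂ (l , _) | vv | inj₂ a | inj₁ b =
              contradiction (≤-level vv) (<⇒≱ (≤-trans (≤-reflexive (≡-sym a))
                (≤-trans (n≤1+n _) (≤-reflexive (trans (cong suc l) (≡-sym b))))))
      ... | inj₁ l | vv | inj₁ a | inj₁ b =
              contradiction (≤-level vv) (<⇒≱ (≤-trans (≤-reflexive (cong suc a))
                (≤-trans (s≤s l) (≤-reflexive (≡-sym b)))))
      ... | inj₁ l | vv | inj₂ a | inj₁ b =
              contradiction (≤-level vv) (<⇒≱ (≤-trans (≤-reflexive (≡-sym a))
                (≤-trans (<⇒≤ l) (≤-trans (n≤1+n _) (≤-reflexive (≡-sym b))))))
      ... | inj₁ l | vv | inj₂ a | inj₂ b =
              contradiction (≤-level vv) (<⇒≱ (≤-trans (≤-reflexive (≡-sym a)) (ℕ.s≤s⁻¹ (≤-trans l (≤-reflexive b)))))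
      ... | inj₁ l | inj₂ (m , lo′ , hi′) | inj₁ a | inj₂ b =
              ~-sym (lo′ (wu , ~-sym uv′ , a)) , ~-sym (hi′ (wu′ , ~-sym u′v , b))
      ... | inj₁ l | inj₁ m | inj₁ a | inj₂ b =
              contradiction (trans (monochrome wv wu same-level) c) (proper _ _ u′v ∘ ≡-sym)
        where
        same-level : level v ≡ level u
        same-level = ≤-antisym (ℕ.s≤s⁻¹ (≤-trans m (≤-reflexive a))) (ℕ.s≤s⁻¹ (≤-trans l (≤-reflexive b)))

      linked? : Decidable (HasNeighbour W)
      linked? u = any? λ v → W? v ×-dec (u ~? v)

      -- Stage 0 collects the vertices without a neighbour in `W`, as `isolated-first` demands; the
      -- vertex index breaks ties and makes the key injective.
      stage key : V → ℕ
      stage u with linked? u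
      ... | yes _ = suc (pos u)
      ... | no _  = 0
      key u = stage u * N + toℕ u

      stage-linked : ∀ {u} → HasNeighbour W u → stage u ≡ suc (pos u)
      stage-linked {u} h with linked? u
      ... | yes _ = refl
      ... | no ¬h = contradiction h ¬h

      linked-stage : ∀ {u} → 0 < stage u → HasNeighbour W u
      linked-stage {u} pos with linked? u
      ... | yes h = h

      key-≤ : ∀ {u v} → key u ≤ key v → stage u < stage v ⊎ stage u ≡ stage v × toℕ u ≤ toℕ v
      key-≤ {u} {v} = lexicographic (stage u) (stage v) (Fin.toℕ<n v)

      stage-≤ : ∀ {u v} → key u ≤ key v → stage u ≤ stage v
      stage-≤ le = case key-≤ le of λ { (inj₁ lt) → <⇒≤ lt ; (inj₂ (eq , _)) → ≤-reflexive eq }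

      pos-mono : ∀ {u v} → HasNeighbour W u → HasNeighbour W v → key u ≤ key v → pos u ≤ pos v
      pos-mono hu hv le = ℕ.s≤s⁻¹ (≤-trans (≤-reflexive (≡-sym (stage-linked hu)))
                            (≤-trans (stage-≤ le) (≤-reflexive (stage-linked hv))))

      key-injective : ∀ {u v} → key u ≡ key v → u ≡ v
      key-injective eq with key-≤ (≤-reflexive eq) | key-≤ (≤-reflexive (≡-sym eq))
      ... | inj₁ lt      | inj₁ gt       = contradiction gt (<-asym lt)
      ... | inj₁ lt      | inj₂ (e , _)  = contradiction (≡-sym e) (<⇒≢ lt)
      ... | inj₂ (e , _) | inj₁ gt       = contradiction (≡-sym e) (<⇒≢ gt)
      ... | inj₂ (_ , p) | inj₂ (_ , q)  = Fin.toℕ-injective (≤-antisym p q)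

    layeredIntervals : Intervals W (d + d)
    layeredIntervals = StrongOrder.strongIntervals W? key key-injective
      (λ wu wu′ wv wv′ c ku kv uv′ u′v →
        strong-pos wu wu′ wv wv′ c (pos-mono (_ , wv′ , uv′) (_ , wv , u′v) ku)
          (pos-mono (_ , wu′ , ~-sym u′v) (_ , wu , ~-sym uv′) kv) uv′ u′v)
      (λ wu wv le hu → linked-stage (<-≤-trans (≤-trans (s≤s z≤n) (≤-reflexive (≡-sym (stage-linked hu)))) (stage-≤ le)))

  -- Breadth-first arms

  module Search (σ : V) {T : V → Set} (T? : Decidable T) where

    -- Balls for walks that start at `σ` and continue inside the territory `T`.
    Within : ℕ → V → Set
    Within zero    v = v ≡ σ
    Within (suc k) v = Within k v ⊎ T v × ∃ λ u → Within k u × u ~ v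

    within? : ∀ k → Decidable (Within k)
    within? zero    v = v Fin.≟ σ
    within? (suc k) v = within? k v ⊎-dec (T? v ×-dec any? (λ u → within? k u ×-dec (u ~? v)))

    within-mono : ∀ {j k v} → j ≤ k → Within j v → Within k v
    within-mono le = mono (≤⇒≤′ le)
      where
      mono : ∀ {j k v} → j ≤′ k → Within j v → Within k v
      mono ≤′-refl      w = w
      mono (≤′-step le) w = inj₁ (mono le w)

    private
      -- The balls grow strictly until they stabilise; the fuel bounds the number of vertices still
      -- outside.
      saturate : ∀ fuel k → n G ≤ count (within? k) + fuel → ∃ λ r → ∀ v → Within (suc r) v → Within r v
      saturate fuel k enough with any? (λ v → within? (suc k) v ×-dec ¬? (within? k v))
      ... | no none = k , λ v w → decidable-stable (within? k v) λ ¬w → none (v , w , ¬w)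
      ... | yes (v , w , ¬w) with fuel | count-strict (within? k) (within? (suc k)) (λ _ → inj₁) v w ¬w
      ...   | zero  | grow = contradiction (<-≤-trans grow (count≤m (within? (suc k))))
                               (≤⇒≯ (≤-trans enough (≤-reflexive (+-identityʳ _))))
      ...   | suc f | grow = saturate f (suc k) (≤-trans enough (≤-trans (≤-reflexive (+-suc _ f)) (+-monoˡ-≤ f grow)))

      abstract
        radius : ∃ λ r → ∀ v → Within (suc r) v → Within r v
        radius = saturate (n G) 0 (m≤n+m _ _)

      -- The first radius at which the vertex appears, capped at the given radius, which is also the
      -- value for unreached vertices.
      depth : ℕ → V → ℕ
      depth zero    v = 0
      depth (suc k) v with within? k v
      ... | yes _ = depth k v
      ... | no _  = suc k

      depth-least : ∀ k {j v} → Within j v → depth k v ≤ j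
      depth-least zero _ = z≤n
      depth-least (suc k) {j} {v} w with within? k v
      ... | yes _ = depth-least k w
      ... | no ¬w = ≰⇒> λ j≤k → ¬w (within-mono j≤k w)

      depth-within : ∀ k {v} → Within k v → Within (depth k v) v
      depth-within zero w = w
      depth-within (suc k) {v} w with within? k v
      ... | yes w′ = depth-within k w′
      ... | no _   = w

      depth-≤ : ∀ k v → depth k v ≤ k
      depth-≤ zero v = z≤n
      depth-≤ (suc k) v with within? k v
      ... | yes _ = m≤n⇒m≤1+n (depth-≤ k v)
      ... | no _  = ≤-refl

    Reach : V → Set
    Reach = Within (proj₁ radius)

    abstract
      reach? : Decidable Reach
      reach? = within? (proj₁ radius)

    dist : V → ℕ
    dist = depth (proj₁ radius)

    reach-step : ∀ {u v} → Reach u → T v → u ~ v → Reach v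
    reach-step ru tv e = proj₂ radius _ (inj₂ (tv , _ , ru , e))

    reach-root : Reach σ
    reach-root = within-mono z≤n refl

    reach-territory : ∀ {v} → Reach v → v ≡ σ ⊎ T v
    reach-territory = go (proj₁ radius)
      where
      go : ∀ k {v} → Within k v → v ≡ σ ⊎ T v
      go zero    e                = inj₁ e
      go (suc k) (inj₁ w)         = go k w
      go (suc k) (inj₂ (t , _))   = inj₂ t

    dist-within : ∀ {v} → Reach v → Within (dist v) v
    dist-within = depth-within (proj₁ radius)

    dist-root : dist σ ≡ 0
    dist-root = n≤0⇒n≡0 (depth-least (proj₁ radius) {0} refl)

    dist-zero : ∀ {v} → Reach v → dist v ≡ 0 → v ≡ σ
    dist-zero {v} rv eq = subst (λ k → Within k v) eq (dist-within rv)

    dist-step : ∀ {u v} → Reach u → Reach v → u ~ v → dist v ≤ suc (dist u)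
    dist-step ru rv e with reach-territory rv
    ... | inj₁ refl = ≤-trans (≤-reflexive dist-root) z≤n
    ... | inj₂ tv   = depth-least (proj₁ radius) (inj₂ (tv , _ , dist-within ru , e))

    parent : ∀ {v i} → Reach v → dist v ≡ suc i → T v × ∃ λ u → Reach u × u ~ v × dist u ≡ i
    parent {v} {i} rv eq with subst (λ k → Within k v) eq (dist-within rv)
    ... | inj₁ w = contradiction (≤-trans (≤-reflexive (≡-sym eq)) (depth-least (proj₁ radius) w)) (n≮n i)
    ... | inj₂ (tv , u , wu , e) = tv , u , ru , e , ≤-antisym (depth-least (proj₁ radius) wu)
            (ℕ.s≤s⁻¹ (≤-trans (≤-reflexive (≡-sym eq)) (dist-step ru rv e)))
      where
      ru : Reach u
      ru = within-mono (≤-trans (n≤1+n i) (≤-trans (≤-reflexive (≡-sym eq)) (depth-≤ (proj₁ radius) v))) wu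

    dist-colour : ∀ {u v} → Reach u → Reach v → dist u ≡ dist v → colour u ≡ colour v
    dist-colour {u} {v} ru rv eq = go (dist u) ru rv refl (≡-sym eq)
      where
      go : ∀ i {u v} → Reach u → Reach v → dist u ≡ i → dist v ≡ i → colour u ≡ colour v
      go zero ru rv eu ev with dist-zero ru eu | dist-zero rv ev
      ... | refl | refl = refl
      go (suc i) ru rv eu ev with parent ru eu | parent rv ev
      ... | _ , _ , rp , pu , ep | _ , _ , rq , qv , eq = sameColour-pair (go i rp rq ep eq) (~-sym pu) (~-sym qv)

    dist-consecutive : ∀ {u v} → Reach u → Reach v → u ~ v → dist v ≡ suc (dist u) ⊎ dist u ≡ suc (dist v)
    dist-consecutive {u} {v} ru rv e with <-cmp (dist u) (dist v)
    ... | tri< lt _ _ = inj₁ (≤-antisym (dist-step ru rv e) lt)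
    ... | tri≈ _ eq _ = contradiction (dist-colour ru rv eq) (proper _ _ e)
    ... | tri> _ _ gt = inj₂ (≤-antisym (dist-step rv ru (~-sym e)) gt)

    apart : ∀ {u v i j} → Reach u → Reach v → dist u ≡ i → dist v ≡ j → suc i < j → ¬ u ~ v
    apart ru rv refl refl lt e = <⇒≱ lt (dist-step ru rv e)

  -- The path τ σ ρ leading into the arm supplies the third leg of the tripods.
  module Arm {σ ρ τ : V} {T : V → Set} (T? : Decidable T)
    (only : ∀ {v} → T v → σ ~ v → v ≡ ρ) (τσ : τ ~ σ)
    (far : ∀ {v} → T v → ρ ~ v → ¬ τ ~ v) where

    open Search σ T? public

    dist-one : ∀ {v} → Reach v → dist v ≡ 1 → v ≡ ρ
    dist-one rv eq with parent rv eq
    ... | tv , u , ru , e , eu with dist-zero ru eu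
    ...   | refl = only tv e

    dist-two : ∀ {v} → Reach v → dist v ≡ 2 → ρ ~ v
    dist-two rv eq with parent rv eq
    ... | _ , u , ru , e , eu = subst (_~ _) (dist-one ru eu) e

    private
      Chain : ℕ → Set
      Chain i = ∀ {u u′ v v′} → Reach u → Reach u′ → Reach v → Reach v′ →
        dist u ≡ i → dist u′ ≡ i → dist v ≡ suc i → dist v′ ≡ suc i → u ~ v → u′ ~ v′ → u ~ v′ ⊎ u′ ~ v

      commonParent : ∀ {i} → Chain i → ∀ {u v} → Reach u → Reach v → dist u ≡ suc i → dist v ≡ suc i →
        ∃ λ s → Reach s × dist s ≡ i × s ~ u × s ~ v
      commonParent ch ru rv eu ev with parent ru eu | parent rv ev
      ... | _ , p , rp , pu , ep | _ , q , rq , qv , eq with ch rp rq ru rv ep eq eu ev pu qv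
      ...   | inj₁ pv = p , rp , ep , pu , pv
      ...   | inj₂ qu = q , rq , eq , qu , qv

      -- The first two levels are single vertices. Beyond them, two independent edges are legs of a
      -- tripod at a common parent `s` of `u` and `u′`, which the chain property one level earlier
      -- provides; the third leg runs two steps back towards the root.
      chain : ∀ i → Chain i
      chain 0 ru ru′ _ _ eu eu′ _ _ uv u′v′ with dist-zero ru eu | dist-zero ru′ eu′
      ... | refl | refl = inj₁ u′v′
      chain 1 ru ru′ _ _ eu eu′ _ _ uv u′v′ with dist-one ru eu | dist-one ru′ eu′
      ... | refl | refl = inj₁ u′v′
      chain (suc (suc i)) {u} {u′} {v} {v′} ru ru′ rv rv′ eu eu′ ev ev′ uv u′v′
        with u ~? v′ | u′ ~? v | commonParent (chain (suc i)) ru ru′ eu eu′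
      ... | yes uv′ | _       | _ = inj₁ uv′
      ... | no _    | yes u′v | _ = inj₂ u′v
      ... | no u≁v′ | no u′≁v | s , rs , es , su , su′ with i
      ...   | zero = ⊥-elim (tripod-free su uv su′ u′v′ (~-sym (proj₁ ρσ)) (~-sym τσ)
                  u≁v′ (far-from ru eu) u′≁v (far-from ru′ eu′) (apart rσ rv eσ ev (s≤s (s≤s z≤n))) (apart rσ rv′ eσ ev′ (s≤s (s≤s z≤n))))
        where
        ρσ : σ ~ s × s ≡ ρ
        ρσ with dist-one rs es | parent rs es
        ... | eq | _ , t , rt , ts , et = subst (_~ s) (dist-zero rt et) ts , eq
        rσ = reach-root
        eσ = dist-root
        far-from : ∀ {x} → Reach x → dist x ≡ 2 → ¬ x ~ τ
        far-from rx ex = far (proj₁ (parent rx ex)) (dist-two rx ex) ∘ ~-sym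
      ...   | suc j with parent rs es
      ...     | _ , t , rt , ts , et with parent rt et
      ...       | _ , g , rg , gt , eg = ⊥-elim (tripod-free su uv su′ u′v′ (~-sym ts) (~-sym gt)
                  u≁v′ (apart rg ru eg eu lt ∘ ~-sym) u′≁v (apart rg ru′ eg eu′ lt ∘ ~-sym)
                  (apart rt rv et ev lt) (apart rt rv′ et ev′ lt))
        where
        lt : ∀ {k} → suc k < suc (suc (suc k))
        lt = s≤s (n≤1+n _)

      -- A parent `q` of `u′` also sees `u` by the chain property. With a common parent `s` of `p`
      -- and `q`, the square `s q u p` has pendants `t`, `u′`, `w` at `s`, `q`, `u`: an armchair. In
      -- the first two cases the level itself, or the one before it, is a single vertex.
      compatible : ∀ i {u u′ p w} → Reach u → Reach u′ → Reach p → Reach w → dist u ≡ suc i → dist u′ ≡ suc i →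
        dist p ≡ i → dist w ≡ suc (suc i) → u ~ p → u ~ w → ¬ u′ ~ p → u′ ~ w
      compatible 0 ru ru′ _ _ eu eu′ _ _ up uw u′≁p with dist-one ru eu | dist-one ru′ eu′
      ... | refl | refl = uw
      compatible 1 {u′ = u′} ru ru′ rp rw eu eu′ ep ew up uw u′≁p =
        contradiction (~-sym (subst (_~ u′) (≡-sym (dist-one rp ep)) (dist-two ru′ eu′))) u′≁p
      compatible (suc (suc j)) {u} {u′} {p} {w} ru ru′ rp rw eu eu′ ep ew up uw u′≁p with parent ru′ eu′
      ... | _ , q , rq , qu′ , eq with chain (suc (suc j)) rp rq ru ru′ ep eq eu eu′ (~-sym up) qu′
                                     | commonParent (chain (suc j)) rp rq ep eq
      ...   | inj₁ pu′ | _ = contradiction (~-sym pu′) u′≁p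
      ...   | inj₂ qu  | s , rs , es , sp , sq with parent rs es
      ...     | _ , t , rt , ts , et = decidable-stable (u′ ~? w) λ u′≁w →
                armchair-free sq qu up (~-sym sp) (~-sym ts) qu′ uw (apart rs rw es ew lt)
                  (apart rt ru et eu lt ∘ ~-sym) (u′≁p ∘ ~-sym) (apart rt ru′ et eu′ lt ∘ ~-sym) u′≁w
        where
        lt : ∀ {k} → suc k < suc (suc (suc k))
        lt = s≤s (n≤1+n _)

    armLayering : Layering Reach
    armLayering = record
      { level = dist ; monochrome = dist-colour ; consecutive = dist-consecutive
      ; chain = λ ru ru′ rv rv′ e ev ev′ → chain _ ru ru′ rv rv′ refl (≡-sym e) ev (trans ev′ (cong suc (≡-sym e)))
      ; compatible = λ ru ru′ rp rw e ep ew → compatible _ ru ru′ rp rw ep (trans (≡-sym e) ep) refl (trans ew (cong suc ep)) }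

  -- Closed pieces and chain graphs

  weaken : ∀ {P Q j k} → Intervals P j → Decidable Q → (∀ {v} → Q v → P v) → j ≤ k → Intervals Q k
  weaken I Q? Q⊆P j≤k = record
    { decide = Q? ; start = start ; end = end ; horizon = horizon
    ; nonempty = nonempty ∘ Q⊆P ; bounded = bounded ∘ Q⊆P ; meets = λ p q → meets (Q⊆P p) (Q⊆P q)
    ; thin = λ t → ≤-trans (count-mono (λ v → Q? v ×-dec (start v ≤? t) ×-dec (t <? end v)) (active? t)
                              λ v (q , a) → Q⊆P q , a) (≤-trans (thin t) j≤k) }
    where open Intervals I

  budget : ℕ
  budget = (d + d) + (d + d)

  record Piece (v : V) : Set₁ where
    field
      Part      : V → Set
      part?     : Decidable Part
      here      : Part v
      closed    : ∀ {u w} → Part u → u ~ w → Part w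
      intervals : Intervals Part budget

  -- A chain graph is a layering with its colour classes as levels; compatibility is vacuous, as it
  -- speaks of three levels.
  twoLevels : ∀ b {W : V → Set} → (∀ {u u′ v v′} → W u → W u′ → W v → W v′ → colour u ≡ b → colour u′ ≡ b →
    u ~ v → u′ ~ v′ → u ~ v′ ⊎ u′ ~ v) → Layering W
  twoLevels b {W} nested = record
    { level = level
    ; monochrome = λ {u} {v} _ _ → mono u v
    ; consecutive = λ {u} {v} _ _ → step u v
    ; chain = λ {u} {u′} {v} wu wu′ wv wv′ l lv _ e e′ →
        nested wu wu′ wv wv′ (low u (low-level u v lv)) (low u′ (trans (≡-sym l) (low-level u v lv))) e e′
    ; compatible = λ {u} {u′} {p} {w} _ _ _ _ _ lp lw → ⊥-elim (high u w lw (trans lp (cong suc (low-level p u lp)))) }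
    where
    level : V → ℕ
    level u with colour u Bool.≟ b
    ... | yes _ = 0
    ... | no _  = 1
    low : ∀ u → level u ≡ 0 → colour u ≡ b
    low u eq with colour u Bool.≟ b
    ... | yes c = c
    mono : ∀ u v → level u ≡ level v → colour u ≡ colour v
    mono u v eq with colour u Bool.≟ b | colour v Bool.≟ b
    ... | yes p | yes q = trans p (≡-sym q)
    ... | no p  | no q  = ≢-≢⇒≡ p q
    step : ∀ u v → u ~ v → level v ≡ suc (level u) ⊎ level u ≡ suc (level v)
    step u v e with colour u Bool.≟ b | colour v Bool.≟ b
    ... | yes p | yes q = contradiction (trans p (≡-sym q)) (proper _ _ e)
    ... | yes p | no q  = inj₁ refl
    ... | no p  | yes q = inj₂ refl
    ... | no p  | no q  = contradiction (≢-≢⇒≡ p q) (proper _ _ e)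
    low-level : ∀ u v → level v ≡ suc (level u) → level u ≡ 0
    low-level u v eq with colour u Bool.≟ b | colour v Bool.≟ b
    ... | yes _ | _ = refl
    low-level u v () | no _ | yes _
    low-level u v () | no _ | no _
    high : ∀ u w → level w ≡ suc (level u) → level u ≢ 1
    high u w eq eq′ with trans (≡-sym (low-level u w eq)) eq′
    ... | ()

  -- The class of v under a symmetric relation with no induced path on five vertices.
  module Class {_↔_ : V → V → Set} (_↔?_ : ∀ u v → Dec (u ↔ v)) (↔-sym : ∀ {u v} → u ↔ v → v ↔ u)
    (no-P₅ : ∀ {a b c e f} → a ↔ b → b ↔ c → c ↔ e → e ↔ f → a ↔ e ⊎ b ↔ f) (v : V) where

    -- `v` is listed separately, since without neighbours it is not its own mate. In the absence of
    -- an induced P₅, three steps from `v` exhaust its class.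
    Mate Other Member : V → Set
    Mate u   = ∃ λ w → v ↔ w × u ↔ w
    Other w  = ∃ λ u → Mate u × u ↔ w
    Member u = u ≡ v ⊎ Mate u ⊎ Other u

    private
      mate? : Decidable Mate
      mate? u = any? λ w → (v ↔? w) ×-dec (u ↔? w)

    abstract
      member? : Decidable Member
      member? u = (u Fin.≟ v) ⊎-dec mate? u ⊎-dec any? (λ w → mate? w ×-dec (w ↔? u))

    member-closed : ∀ {u w} → Member u → u ↔ w → Member w
    member-closed (inj₁ refl)        e = inj₂ (inj₂ (v , (_ , e , e) , e))
    member-closed (inj₂ (inj₁ m))    e = inj₂ (inj₂ (_ , m , e))
    -- The path from `v` through `w` and `u` to the new vertex has four edges, and either chord
    -- makes the new vertex a mate of `v`.
    member-closed (inj₂ (inj₂ (u , (w , vw , uw) , ux))) e with no-P₅ vw (↔-sym uw) ux e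
    ... | inj₁ vx = inj₂ (inj₁ (_ , vx , ↔-sym e))
    ... | inj₂ wy = inj₂ (inj₁ (w , vw , ↔-sym wy))

    -- The path `u a v b u′` has a chord, so `u` and `u′` share a neighbour; placing it between
    -- them, the path from `w` to `w′` through `u` and `u′` has a chord as well.
    mates-nested : ∀ {u u′ w w′} → Mate u → Mate u′ → u ↔ w → u′ ↔ w′ → u ↔ w′ ⊎ u′ ↔ w
    mates-nested {u} {u′} {w} {w′} (a , va , ua) (b , vb , ub) uw uw′ with no-P₅ ua (↔-sym va) vb (↔-sym ub)
    ... | inj₁ u-b = [ inj₂ ∘ ↔-sym , inj₁ ]′ (no-P₅ (↔-sym uw) u-b (↔-sym ub) uw′)
    ... | inj₂ a-u = [ inj₂ ∘ ↔-sym , inj₁ ]′ (no-P₅ (↔-sym uw) ua a-u uw′)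

    module _ (bichromatic : ∀ {u w} → u ↔ w → colour u ≢ colour w) where

      member-mate : ∀ {u w} → Member u → colour u ≡ colour v → u ↔ w → Mate u
      member-mate (inj₁ refl) _ e = _ , e , e
      member-mate (inj₂ (inj₁ m)) _ _ = m
      member-mate (inj₂ (inj₂ (x , (w , vw , xw) , xu))) c _ =
        contradiction (trans (≢-≢⇒≡ (bichromatic xw) (bichromatic vw)) (≡-sym c)) (bichromatic xu)

  -- Comparable neighbourhoods, and covering the graph by pieces

  Incomparable : V → V → Set
  Incomparable x y = (∃ λ k → k ~ x × k ~ y) × (∃ λ p → p ~ x × ¬ p ~ y) × (∃ λ q → q ~ y × ¬ q ~ x)

  incomparable? : ∀ x y → Dec (Incomparable x y)
  incomparable? x y = any? (λ k → (k ~? x) ×-dec (k ~? y))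
    ×-dec any? (λ p → (p ~? x) ×-dec ¬? (p ~? y)) ×-dec any? (λ q → (q ~? y) ×-dec ¬? (q ~? x))

  comparable-piece : ∀ {Live : V → Set} (live? : Decidable Live) → (∀ {u w} → Live u → u ~ w → Live w) →
    (∀ {x y} → Live x → ¬ Incomparable x y) → ∀ {v} → Live v → Piece v
  comparable-piece {Live} live? live-closed comparable {v} lv = record
    { Part = Member ; part? = member? ; here = inj₁ refl
    ; closed = λ m e → member-closed m (member-live m , e)
    ; intervals = weaken (layeredIntervals member? (twoLevels (colour v) λ wu wu′ _ _ c c′ e e′ →
          [ inj₁ ∘ proj₂ , inj₂ ∘ proj₂ ]′
            (mates-nested (member-mate bichromatic wu c (member-live wu , e)) (member-mate bichromatic wu′ c′ (member-live wu′ , e′))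
              (member-live wu , e) (member-live wu′ , e′))))
        member? id (m≤m+n _ _) }
    where
    -- On an induced path `a b c e f` the vertices `b` and `e` would be incomparable, with `c` in
    -- common.
    no-P₅ : ∀ {a b c e f} → Live a × a ~ b → Live b × b ~ c → Live c × c ~ e → Live e × e ~ f →
      (Live a × a ~ e) ⊎ (Live b × b ~ f)
    no-P₅ {a} {b} {c} {e} {f} (la , ab) (lb , bc) (lc , ce) (le , ef) with a ~? e | b ~? f
    ... | yes ae | _      = inj₁ (la , ae)
    ... | no _   | yes bf = inj₂ (lb , bf)
    ... | no a≁e | no b≁f = contradiction
            ((c , ~-sym bc , ce) , (a , ab , a≁e) , (f , ~-sym ef , b≁f ∘ ~-sym)) (comparable lb)
    open Class (λ u w → live? u ×-dec (u ~? w)) (λ (l , e) → live-closed l e , ~-sym e) no-P₅ v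
    bichromatic : ∀ {u w} → Live u × u ~ w → colour u ≢ colour w
    bichromatic (_ , e) = proper _ _ e
    member-live : ∀ {u} → Member u → Live u
    member-live (inj₁ refl) = lv
    member-live (inj₂ (inj₁ (_ , _ , l , _))) = l
    member-live (inj₂ (inj₂ (_ , _ , l , e))) = live-closed l e

  -- Pieces are split off from the complement of the closed set `C` covered so far. Each one adds at
  -- least the vertex `v`, and the fuel bounds the number of uncovered vertices.
  cover : (∀ {Live : V → Set} → Decidable Live → (∀ {u w} → Live u → u ~ w → Live w) → ∃ Live → ∃ λ v → Live v × Piece v) →
    Intervals (λ _ → ⊤) budget
  cover peel = go (n G) (λ _ → ⊥) nobody? (λ ()) (m≤n+m _ _) none
    where
    nobody? : Decidable {A = V} (λ _ → ⊥)
    nobody? _ = no λ ()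
    inactive? : ∀ t → Decidable {A = V} (λ _ → ⊥ × 0 ≤ t × t < 0)
    inactive? t v = nobody? v ×-dec (0 ≤? t) ×-dec (t <? 0)
    none : Intervals (λ _ → ⊥) budget
    none = record { decide = nobody? ; start = λ _ → 0 ; end = λ _ → 0 ; horizon = 0
      ; nonempty = λ () ; bounded = λ () ; meets = λ ()
      ; thin = λ t → ≤-trans (≤-reflexive (count-none (inactive? t) λ _ ())) z≤n }
    go : ∀ fuel (C : V → Set) (C? : Decidable C) → (∀ {u w} → C u → u ~ w → C w) →
      n G ≤ count C? + fuel → Intervals C budget → Intervals (λ _ → ⊤) budget
    go fuel C C? closed enough I with any? (λ v → ¬? (C? v))
    ... | no all = weaken I (λ _ → yes tt) (λ {v} _ → decidable-stable (C? v) λ ¬c → all (v , ¬c)) ≤-refl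
    ... | yes uncovered with peel (λ v → ¬? (C? v)) (λ ¬c e c → ¬c (closed c (~-sym e))) uncovered
    ...   | v , ¬cv , piece with fuel
    ...     | zero = contradiction (<-≤-trans (count-strict C? (λ _ → yes tt) (λ _ _ → tt) v tt ¬cv) (count≤m {P = λ _ → ⊤} (λ _ → yes tt)))
                       (≤⇒≯ (≤-trans enough (≤-reflexive (+-identityʳ _))))
    ...     | suc f = go f C′ C′? closed′
                (≤-trans enough (≤-trans (≤-reflexive (+-suc _ f)) (+-monoˡ-≤ f
                  (count-strict C? C′? (λ _ → inj₁) v (inj₂ P.here) ¬cv))))
                (concatenate I (weaken P.intervals (λ v → P.part? v ×-dec ¬? (C? v)) proj₁ ≤-refl) C′? split
                  λ c (_ , ¬c) e → ¬c (closed c e))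
      where
      module P = Piece piece
      C′ : V → Set
      C′ v = C v ⊎ P.Part v
      C′? : Decidable C′
      C′? v = C? v ⊎-dec P.part? v
      closed′ : ∀ {u w} → C′ u → u ~ w → C′ w
      closed′ (inj₁ c) e = inj₁ (closed c e)
      closed′ (inj₂ p) e = inj₂ (P.closed p e)
      split : ∀ {v} → C′ v → C v ⊎ (P.Part v × ¬ C v)
      split (inj₁ c) = inj₁ c
      split {v} (inj₂ p) with C? v
      ... | yes c = inj₁ c
      ... | no ¬c = inj₂ (p , ¬c)

  -- The sparse case: two arms and a small cut

  restrict : ∀ {P Q} → (∀ {v} → Q v → P v) → Layering P → Layering Q
  restrict Q⊆P L = record
    { level = level
    ; monochrome = λ p q → monochrome (Q⊆P p) (Q⊆P q)
    ; consecutive = λ p q → consecutive (Q⊆P p) (Q⊆P q)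
    ; chain = λ p q r s → chain (Q⊆P p) (Q⊆P q) (Q⊆P r) (Q⊆P s)
    ; compatible = λ p q r s → compatible (Q⊆P p) (Q⊆P q) (Q⊆P r) (Q⊆P s) }
    where open Layering L

  -- K is the common neighbourhood of x and y. Deleting a small vertex cover S of the chain graph
  -- between its full neighbours and N(y) ∖ N(x) leaves two arms, one behind x and one behind y.
  module Arms {x y k₀ p₀ : V} (k₀x : k₀ ~ x) (k₀y : k₀ ~ y) (p₀x : p₀ ~ x) (p₀≁y : ¬ p₀ ~ y)
    (within : ∀ {k z w} → k ~ x → k ~ y → k ~ z → w ~ z → w ~ x ⊎ w ~ y)
    (saturated : ∀ {k k′ z w} → k ~ x → k ~ y → k ~ z → w ~ z → ¬ (w ~ x × w ~ y) → k′ ~ x → k′ ~ y → k′ ~ z) where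

    -- `x` and `y` themselves belong to `Full`. By `saturated`, a vertex of `Z` outside `Full` sees
    -- nothing but `K`; these are the leaves.
    K X Y Z Full : V → Set
    K k = k ~ x × k ~ y
    X w = w ~ x × ¬ w ~ y
    Y w = w ~ y × ¬ w ~ x
    Z z = ∃ λ k → K k × k ~ z
    Full z = ∀ k → K k → k ~ z

    abstract
      K? : Decidable K
      K? k = (k ~? x) ×-dec (k ~? y)
      Y? : Decidable Y
      Y? w = (w ~? y) ×-dec ¬? (w ~? x)
      Z? : Decidable Z
      Z? z = any? λ k → K? k ×-dec (k ~? z)
      full? : Decidable Full
      full? z = all? λ k → K? k →-dec (k ~? z)

    Full⇒Z : ∀ {z} → Full z → Z z
    Full⇒Z f = k₀ , (k₀x , k₀y) , f k₀ (k₀x , k₀y)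

    x~⇒¬Z : ∀ {w} → w ~ x → ¬ Z w
    x~⇒¬Z wx (k , (kx , _) , kw) = proper _ _ kx (sameColour kw wx)

    y~⇒¬Z : ∀ {w} → w ~ y → ¬ Z w
    y~⇒¬Z wy (k , (_ , ky) , kw) = proper _ _ ky (sameColour kw wy)

    Z-colour : ∀ {z} → Z z → colour z ≡ colour x
    Z-colour (k , (kx , _) , kz) = sameColour (~-sym kz) kx

    leaf-neighbours : ∀ {z w} → Z z → ¬ Full z → w ~ z → K w
    leaf-neighbours {z} {w} (k , (kx , ky) , kz) ¬f wz =
      decidable-stable (K? w) λ ¬k → ¬f λ k′ (k′x , k′y) → saturated kx ky kz wz ¬k k′x k′y

    full-neighbours : ∀ {z w} → Z z → w ~ z → K w ⊎ X w ⊎ Y w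
    full-neighbours {z} {w} (k , (kx , ky) , kz) wz with w ~? x | w ~? y | within kx ky kz wz
    ... | yes wx | yes wy | _ = inj₁ (wx , wy)
    ... | yes wx | no ¬wy | _ = inj₂ (inj₁ (wx , ¬wy))
    ... | no ¬wx | yes wy | _ = inj₂ (inj₂ (wy , ¬wx))
    ... | no ¬wx | no ¬wy | r = ⊥-elim ([ ¬wx , ¬wy ]′ r)

    -- Two independent edges would give the squares `k₀ z w y` and `k₀ z′ w′ y` on the edge `k₀ y`,
    -- a stirrer with pendant `x` at `k₀`.
    chainY : ∀ {z z′ w w′} → Full z → Full z′ → Y w → Y w′ → z ~ w → z′ ~ w′ → z ~ w′ ⊎ z′ ~ w
    chainY {z} {z′} {w} {w′} f f′ (wy , w≁x) (w′y , w′≁x) zw z′w′ with z ~? w′ | z′ ~? w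
    ... | yes p | _     = inj₁ p
    ... | no _  | yes q = inj₂ q
    ... | no ¬p | no ¬q = ⊥-elim (stirrer-free k₀y (f k₀ (k₀x , k₀y)) zw wy (f′ k₀ (k₀x , k₀y)) z′w′ w′y k₀x
                            ¬p ¬q (w≁x ∘ ~-sym) (w′≁x ∘ ~-sym))

    chainX : ∀ {z z′ w w′} → Full z → Full z′ → X w → X w′ → z ~ w → z′ ~ w′ → z ~ w′ ⊎ z′ ~ w
    chainX {z} {z′} {w} {w′} f f′ (wx , w≁y) (w′x , w′≁y) zw z′w′ with z ~? w′ | z′ ~? w
    ... | yes p | _     = inj₁ p
    ... | no _  | yes q = inj₂ q
    ... | no ¬p | no ¬q = ⊥-elim (stirrer-free k₀x (f k₀ (k₀x , k₀y)) zw wx (f′ k₀ (k₀x , k₀y)) z′w′ w′x k₀y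
                            ¬p ¬q (w≁y ∘ ~-sym) (w′≁y ∘ ~-sym))

    private
      FullAt : V → V → Set
      FullAt w z = Full z × z ~ w
      fullAt? : ∀ w → Decidable (FullAt w)
      fullAt? w z = full? z ×-dec (z ~? w)
      degree : V → ℕ
      degree w = count (fullAt? w)

      degree-< : ∀ {z w w′} → Y w → Y w′ → FullAt w z → ¬ z ~ w′ → degree w′ < degree w
      degree-< {z} {w} {w′} yw yw′ (f , zw) z≁w′ = count-strict (fullAt? w′) (fullAt? w)
        (λ z′ (f′ , z′w′) → f′ , [ (λ p → contradiction p z≁w′) , id ]′ (chainY f f′ yw yw′ zw z′w′))
        z (f , zw) (z≁w′ ∘ proj₂)

    -- A vertex cover of the chain graph between `Full` and `Y`: the vertices of `Y` of degree above
    -- `d`, and all full neighbours of the others.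
    SY SZ S : V → Set
    SY w = Y w × d < degree w
    SZ z = Full z × ∃ λ w → (Y w × degree w ≤ d) × z ~ w
    S v = SZ v ⊎ SY v

    private
      light? : Decidable (λ w → Y w × degree w ≤ d)
      light? w = Y? w ×-dec (degree w ≤? d)

    abstract
      SY? : Decidable SY
      SY? w = Y? w ×-dec (d <? degree w)
      SZ? : Decidable SZ
      SZ? z = full? z ×-dec any? (λ w → light? w ×-dec (z ~? w))
      S? : Decidable S
      S? v = SZ? v ⊎-dec SY? v

    S-covers : ∀ {z w} → Full z → Y w → z ~ w → S z ⊎ S w
    S-covers {z} {w} f yw zw with degree w ≤? d
    ... | yes small = inj₁ (inj₁ (f , w , (yw , small) , zw))
    ... | no big    = inj₂ (inj₂ (yw , ≰⇒> big))

    private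
      -- Neighbourhoods of light vertices are nested, so all of them lie in the largest, which has
      -- at most `d` elements.
      SZ-small : count SZ? ≤ d
      SZ-small with any? light?
      ... | no none = ≤-trans (≤-reflexive (count-none SZ? λ z (_ , w , l , _) → none (w , l))) z≤n
      ... | yes some with argmax light? degree some
      ...   | w′ , (yw′ , small) , max = ≤-trans (count-mono SZ? (fullAt? w′) inside′) small
        where
        inside′ : ∀ z → SZ z → FullAt w′ z
        inside′ z (f , w , (yw , l) , zw) = f , decidable-stable (z ~? w′) λ z≁w′ →
          <⇒≱ (degree-< yw yw′ (f , zw) z≁w′) (max w (yw , l))

      -- By nestedness all heavy vertices see the more than `d` full neighbours of the lightest
      -- among them, so there is no room for `d + 1` of them.
      SY-small : count SY? ≤ d
      SY-small with count SY? ≤? d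
      ... | yes small = small
      ... | no big with argmin SY? degree (count>0 SY? (≤-<-trans z≤n (≰⇒> big)))
      ...   | w′ , (yw′ , heavy) , min = ⊥-elim (biclique-free (fullAt? w′) SY? joined heavy (≰⇒> big))
        where
        joined : ∀ {z w} → FullAt w′ z → SY w → z ~ w
        joined {z} {w} fz s = decidable-stable (z ~? w) λ z≁w → <⇒≱ (degree-< yw′ (proj₁ s) fz z≁w) (min w s)

    S-small : count S? ≤ d + d
    S-small = ≤-trans (count-∪ S? SZ? SY? λ _ → id) (+-mono-≤ SZ-small SY-small)

    S⇒Z⊎Y : ∀ {v} → S v → Z v ⊎ Y v
    S⇒Z⊎Y (inj₁ (f , _)) = inj₁ (Full⇒Z f)
    S⇒Z⊎Y (inj₂ (yv , _)) = inj₂ yv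

    T : V → Set
    T v = v ≡ x ⊎ (¬ S v × ¬ Z v × ¬ K v)
    abstract
      T? : Decidable T
      T? v = (v Fin.≟ x) ⊎-dec (¬? (S? v) ×-dec ¬? (Z? v) ×-dec ¬? (K? v))

    private
      x-only : ∀ {v} → T v → k₀ ~ v → v ≡ x
      x-only (inj₁ e) _ = e
      x-only (inj₂ (_ , ¬z , _)) e = contradiction (k₀ , (k₀x , k₀y) , e) ¬z
      x-far : ∀ {v} → T v → x ~ v → ¬ y ~ v
      x-far (inj₁ refl) e _ = proper _ _ e refl
      x-far (inj₂ (_ , _ , ¬k)) xv yv = ¬k (~-sym xv , ~-sym yv)
    module A = Arm {k₀} {x} {y} T? x-only (~-sym k₀y) x-far

    -- Vertices of `S` in `Y` may be entered here: they have to be reached for `Whole` to be closed,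
    -- and `Right` drops them again.
    T′ : V → Set
    T′ v = v ≡ y ⊎ (¬ Z v × ¬ K v × ¬ A.Reach v)
    abstract
      T′? : Decidable T′
      T′? v = (v Fin.≟ y) ⊎-dec (¬? (Z? v) ×-dec ¬? (K? v) ×-dec ¬? (A.reach? v))

    private
      y-only : ∀ {v} → T′ v → k₀ ~ v → v ≡ y
      y-only (inj₁ e) _ = e
      y-only (inj₂ (¬z , _)) e = contradiction (k₀ , (k₀x , k₀y) , e) ¬z
      y-far : ∀ {v} → T′ v → y ~ v → ¬ x ~ v
      y-far (inj₁ refl) e _ = proper _ _ e refl
      y-far (inj₂ (_ , ¬k , _)) yv xv = ¬k (~-sym xv , ~-sym yv)
    module B = Arm {k₀} {y} {x} T′? y-only (~-sym k₀x) y-far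

    x-reached : A.Reach x
    x-reached = A.reach-step A.reach-root (inj₁ refl) k₀x
    y-reached : B.Reach y
    y-reached = B.reach-step B.reach-root (inj₁ refl) k₀y

    ¬S-k₀ : ¬ S k₀
    ¬S-k₀ s with S⇒Z⊎Y s
    ... | inj₁ z = x~⇒¬Z k₀x z
    ... | inj₂ (_ , ¬x) = ¬x k₀x

    ¬S-x : ¬ S x
    ¬S-x (inj₁ (_ , w , ((_ , w≁x) , _) , xw)) = w≁x (~-sym xw)
    ¬S-x (inj₂ ((xy , _) , _)) = proper _ _ xy (sameColour (~-sym k₀x) k₀y)

    ¬S-reached : ∀ {v} → A.Reach v → ¬ S v
    ¬S-reached r with A.reach-territory r
    ... | inj₁ refl             = ¬S-k₀
    ... | inj₂ (inj₁ refl)      = ¬S-x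
    ... | inj₂ (inj₂ (¬s , _))  = ¬s

    X⇒reached : ∀ {w} → X w → A.Reach w
    X⇒reached (wx , w≁y) = A.reach-step x-reached (inj₂ (¬s , x~⇒¬Z wx , w≁y ∘ proj₂)) (~-sym wx)
      where
      ¬s : ¬ S _
      ¬s s with S⇒Z⊎Y s
      ... | inj₁ z = x~⇒¬Z wx z
      ... | inj₂ (_ , w≁x) = w≁x wx

    Y⇒reached : ∀ {w} → Y w → A.Reach w ⊎ B.Reach w
    Y⇒reached {w} (wy , w≁x) with A.reach? w
    ... | yes a = inj₁ a
    ... | no ¬a = inj₂ (B.reach-step y-reached (inj₂ (y~⇒¬Z wy , w≁x ∘ proj₁ , ¬a)) (~-sym wy))

    Left Right : V → Set
    Left v  = K v ⊎ (Z v × ¬ S v) ⊎ A.Reach v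
    Right v = B.Reach v × ¬ Z v × ¬ K v × ¬ A.Reach v × ¬ S v

    abstract
      left? : Decidable Left
      left? v = K? v ⊎-dec (Z? v ×-dec ¬? (S? v)) ⊎-dec A.reach? v
      right? : Decidable Right
      right? v = B.reach? v ×-dec ¬? (Z? v) ×-dec ¬? (K? v) ×-dec ¬? (A.reach? v) ×-dec ¬? (S? v)

    -- Leaves, `K` and full vertices take levels 0 to 2. Arm vertices get their distance from `k₀`
    -- plus one, which puts `k₀` and `x` on the levels of `K` and `Full`, so `deep` begins at level
    -- 3.
    data Stratum (v : V) : ℕ → Set where
      leaf : Z v → ¬ Full v → Stratum v 0
      core : K v → Stratum v 1
      full : Full v → ¬ S v → Stratum v 2
      deep : ∀ {i} → A.Reach v → ¬ Z v → ¬ K v → A.dist v ≡ suc (suc i) → Stratum v (suc (suc (suc i)))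

    private
      levelOf : ∀ {P Q R : Set} → Dec P → Dec Q → Dec R → ℕ → ℕ
      levelOf (yes _) _       _       _ = 1
      levelOf (no _)  (yes _) (yes _) _ = 2
      levelOf (no _)  (yes _) (no _)  _ = 0
      levelOf (no _)  (no _)  _       i = suc i

      level : V → ℕ
      level v = levelOf (K? v) (Z? v) (full? v) (A.dist v)

      deepStratum : ∀ {v} i → A.Reach v → ¬ K v → ¬ Z v → A.dist v ≡ i → Stratum v (suc i)
      deepStratum 0 r ¬k ¬z eq = contradiction (subst K (≡-sym (A.dist-zero r eq)) (k₀x , k₀y)) ¬k
      deepStratum 1 r ¬k ¬z eq = contradiction (subst Z (≡-sym (A.dist-one r eq)) (k₀ , (k₀x , k₀y) , k₀x)) ¬z
      deepStratum (suc (suc i)) r ¬k ¬z eq = deep r ¬z ¬k eq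

      stratumOf : ∀ {v} (k : Dec (K v)) (z : Dec (Z v)) (f : Dec (Full v)) → Left v → Stratum v (levelOf k z f (A.dist v))
      stratumOf (yes k) _       _       _                        = core k
      stratumOf (no ¬k) (yes z) (no ¬f) _                        = leaf z ¬f
      stratumOf (no ¬k) (yes z) (yes f) (inj₁ k)                 = contradiction k ¬k
      stratumOf (no ¬k) (yes z) (yes f) (inj₂ (inj₁ (_ , ¬s)))   = full f ¬s
      stratumOf (no ¬k) (yes z) (yes f) (inj₂ (inj₂ r))          = full f (¬S-reached r)
      stratumOf (no ¬k) (no ¬z) _       (inj₁ k)                 = contradiction k ¬k
      stratumOf (no ¬k) (no ¬z) _       (inj₂ (inj₁ (z , _)))    = contradiction z ¬z
      stratumOf (no ¬k) (no ¬z) _       (inj₂ (inj₂ r))          = deepStratum _ r ¬k ¬z refl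

      stratum : ∀ {v} → Left v → Stratum v (level v)
      stratum {v} = stratumOf (K? v) (Z? v) (full? v)

      -- A neighbour in `Y` would leave an edge uncovered, since neither end is in `S`.
      above-full : ∀ {z w} → Full z → ¬ S z → A.Reach w → ¬ K w → z ~ w → X w
      above-full f ¬s r ¬k zw with full-neighbours (Full⇒Z f) (~-sym zw)
      ... | inj₁ k        = contradiction k ¬k
      ... | inj₂ (inj₁ c) = c
      ... | inj₂ (inj₂ c) = ⊥-elim ([ ¬s , ¬S-reached r ]′ (S-covers f c zw))

      strata-colour : ∀ {u v i} → Stratum u i → Stratum v i → colour u ≡ colour v
      strata-colour (leaf z _) (leaf z′ _) = trans (Z-colour z) (≡-sym (Z-colour z′))
      strata-colour (core (ux , _)) (core (vx , _)) = sameColour ux (~-sym vx)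
      strata-colour (full f _) (full f′ _) = trans (Z-colour (Full⇒Z f)) (≡-sym (Z-colour (Full⇒Z f′)))
      strata-colour (deep r _ _ e) (deep r′ _ _ e′) = A.dist-colour r r′ (trans e (≡-sym e′))

      X-dist : ∀ {w i} → A.Reach w → X w → A.dist w ≡ suc (suc i) → i ≡ 0
      X-dist r (wx , _) eq = n≤0⇒n≡0 (ℕ.s≤s⁻¹ (ℕ.s≤s⁻¹ (≤-trans (≤-reflexive (≡-sym eq))
        (≤-trans (A.dist-step x-reached r (~-sym wx)) (s≤s (≤-trans (A.dist-step A.reach-root x-reached k₀x)
          (≤-reflexive (cong suc A.dist-root))))))))

      core-stratum : ∀ {v j} → K v → Stratum v j → j ≡ 1
      core-stratum k (leaf z _)      = contradiction z (x~⇒¬Z (proj₁ k))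
      core-stratum k (core _)        = refl
      core-stratum k (full f _)      = contradiction (Full⇒Z f) (x~⇒¬Z (proj₁ k))
      core-stratum k (deep _ _ ¬k _) = contradiction k ¬k

      strata-step : ∀ {u v i j} → Stratum u i → Stratum v j → u ~ v → j ≡ suc i ⊎ i ≡ suc j
      strata-step (leaf z ¬f) v e = inj₁ (core-stratum (leaf-neighbours z ¬f (~-sym e)) v)
      strata-step u (leaf z ¬f) e = inj₂ (core-stratum (leaf-neighbours z ¬f e) u)
      strata-step (core (ux , _)) (core (vx , _)) e = contradiction (sameColour ux (~-sym vx)) (proper _ _ e)
      strata-step (core _) (full _ _) e = inj₁ refl
      strata-step (full _ _) (core _) e = inj₂ refl
      strata-step (core k) (deep _ ¬z _ _) e = contradiction (_ , k , e) ¬z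
      strata-step (deep _ ¬z _ _) (core k) e = contradiction (_ , k , ~-sym e) ¬z
      strata-step (full f s) (full f′ s′) e = contradiction (strata-colour (full f s) (full f′ s′)) (proper _ _ e)
      strata-step (full f ¬s) (deep r _ ¬k eq) e = inj₁ (cong (λ i → suc (suc (suc i))) (X-dist r (above-full f ¬s r ¬k e) eq))
      strata-step (deep r _ ¬k eq) (full f ¬s) e = inj₂ (cong (λ i → suc (suc (suc i))) (X-dist r (above-full f ¬s r ¬k (~-sym e)) eq))
      strata-step (deep r _ _ eq) (deep r′ _ _ eq′) e with A.dist-consecutive r r′ e
      ... | inj₁ h = inj₁ (cong suc (trans (≡-sym eq′) (trans h (cong suc eq))))
      ... | inj₂ h = inj₂ (cong suc (trans (≡-sym eq) (trans h (cong suc eq′))))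

      module AL = Layering A.armLayering

      strata-chain : ∀ {u u′ v v′ i} → Stratum u i → Stratum u′ i → Stratum v (suc i) → Stratum v′ (suc i) →
        u ~ v → u′ ~ v′ → u ~ v′ ⊎ u′ ~ v
      strata-chain {u} {u′} {v} {v′} (leaf z ¬f) (leaf z′ ¬f′) (core (vx , vy)) (core (v′x , v′y)) uv u′v′
        with u ~? v′ | u′ ~? v
      ... | yes p | _     = inj₁ p
      ... | no _  | yes q = inj₂ q
      -- The square `v x v′ y` has pendants `u`, `p₀`, `u′` at `v`, `x`, `v′`; leaves miss `p₀`
      -- because they see only `K`.
      ... | no ¬p | no ¬q = ⊥-elim (armchair-free vx (~-sym v′x) v′y (~-sym vy) (~-sym uv) (~-sym p₀x) (~-sym u′v′)
              (¬q ∘ ~-sym) (¬p ∘ ~-sym) (p₀≁y ∘ ~-sym)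
              (p₀≁y ∘ proj₂ ∘ leaf-neighbours z ¬f) (p₀≁y ∘ proj₂ ∘ leaf-neighbours z′ ¬f′))
      strata-chain (core k) _ _ (full f′ _) _ _ = inj₁ (f′ _ k)
      strata-chain (full f ¬s) (full f′ ¬s′) (deep r _ ¬k _) (deep r′ _ ¬k′ _) uv u′v′ =
        chainX f f′ (above-full f ¬s r ¬k uv) (above-full f′ ¬s′ r′ ¬k′ u′v′) uv u′v′
      strata-chain (deep r _ _ e) (deep r′ _ _ e′) (deep s _ _ g) (deep s′ _ _ g′) =
        AL.chain r r′ s s′ (trans e (≡-sym e′)) (trans g (cong suc (≡-sym e))) (trans g′ (cong suc (≡-sym e′)))

      strata-compatible : ∀ {u u′ p w i} → Stratum u (suc i) → Stratum u′ (suc i) → Stratum p i → Stratum w (suc (suc i)) →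
        u ~ p → u ~ w → ¬ u′ ~ p → u′ ~ w
      strata-compatible (core _) (core k′) _ (full f _) _ _ _ = f _ k′
      strata-compatible (full _ _) (full f′ _) (core k) _ _ _ u′≁p = contradiction (~-sym (f′ _ k)) u′≁p
      strata-compatible {u} {u′} {p} {w} (deep r _ ¬k e) (deep r′ _ ¬k′ e′) (full f _) (deep _ ¬z _ _) up uw u′≁p =
        -- The square `k₀ x u p` with pendants `y`, `u′`, `w` at `k₀`, `x`, `u`.
        decidable-stable (u′ ~? w) λ u′≁w → armchair-free k₀x xu up (~-sym (f k₀ (k₀x , k₀y))) k₀y xu′ uw
          (λ k₀w → ¬z (k₀ , (k₀x , k₀y) , k₀w)) (λ uy → ¬k (~-sym xu , uy)) (u′≁p ∘ ~-sym)
          (λ u′y → ¬k′ (~-sym xu′ , u′y)) u′≁w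
        where
        xu : x ~ u
        xu = A.dist-two r e
        xu′ : x ~ u′
        xu′ = A.dist-two r′ e′
      strata-compatible (deep r _ _ e) (deep r′ _ _ e′) (deep s _ _ g) (deep t _ _ h) =
        AL.compatible r r′ s t (trans e (≡-sym e′)) (trans e (cong suc (≡-sym g))) (trans h (cong suc (≡-sym e)))

    leftLayering : Layering Left
    leftLayering = record
      { level = level
      ; monochrome = λ {u} {v} lu lv e → strata-colour (stratum lu) (subst (Stratum v) (≡-sym e) (stratum lv))
      ; consecutive = λ lu lv → strata-step (stratum lu) (stratum lv)
      ; chain = λ {u} {u′} {v} {v′} lu lu′ lv lv′ e ev ev′ → strata-chain (stratum lu)
          (subst (Stratum u′) (≡-sym e) (stratum lu′)) (subst (Stratum v) ev (stratum lv))
          (subst (Stratum v′) (trans ev′ (cong suc (≡-sym e))) (stratum lv′))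
      ; compatible = λ {u} {u′} {p} {w} lu lu′ lp lw e ep ew → strata-compatible
          (subst (Stratum u) ep (stratum lu)) (subst (Stratum u′) (trans (≡-sym e) ep) (stratum lu′))
          (stratum lp) (subst (Stratum w) (trans ew (cong suc ep)) (stratum lw)) }

    private
      separated : ∀ {u v} → Left u → Right v → ¬ u ~ v
      separated (inj₁ k) (_ , ¬z , _) e = ¬z (_ , k , e)
      separated {u} (inj₂ (inj₁ (z , ¬s))) (_ , _ , ¬k , ¬a , ¬s′) e with full? u | full-neighbours z (~-sym e)
      ... | no ¬f | _              = ¬k (leaf-neighbours z ¬f (~-sym e))
      ... | yes f | inj₁ k         = ¬k k
      ... | yes f | inj₂ (inj₁ c)  = ¬a (X⇒reached c)
      ... | yes f | inj₂ (inj₂ c)  = [ ¬s , ¬s′ ]′ (S-covers f c e)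
      separated (inj₂ (inj₂ a)) (_ , ¬z , ¬k , ¬a , ¬s) e = ¬a (A.reach-step a (inj₂ (¬s , ¬z , ¬k)) e)

    Whole : V → Set
    Whole v = K v ⊎ Z v ⊎ A.Reach v ⊎ B.Reach v

    private
      abstract
        whole? : Decidable Whole
        whole? v = K? v ⊎-dec Z? v ⊎-dec A.reach? v ⊎-dec B.reach? v

      Y⇒whole : ∀ {w} → Y w → Whole w
      Y⇒whole c = inj₂ (inj₂ (Y⇒reached c))

      whole-closed : ∀ {u w} → Whole u → u ~ w → Whole w
      whole-closed (inj₁ k) e = inj₂ (inj₁ (_ , k , e))
      whole-closed (inj₂ (inj₁ z)) e with full-neighbours z (~-sym e)
      ... | inj₁ k        = inj₁ k
      ... | inj₂ (inj₁ c) = inj₂ (inj₂ (inj₁ (X⇒reached c)))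
      ... | inj₂ (inj₂ c) = Y⇒whole c
      whole-closed {u} {w} (inj₂ (inj₂ r)) e with K? w | Z? w | A.reach? w
      ... | yes k | _     | _     = inj₁ k
      ... | no _  | yes z | _     = inj₂ (inj₁ z)
      ... | no _  | no _  | yes a = inj₂ (inj₂ (inj₁ a))
      whole-closed {u} {w} (inj₂ (inj₂ (inj₂ b))) e | no ¬k | no ¬z | no ¬a =
        inj₂ (inj₂ (inj₂ (B.reach-step b (inj₂ (¬z , ¬k , ¬a)) e)))
      whole-closed {u} {w} (inj₂ (inj₂ (inj₁ a))) e | no ¬k | no ¬z | no ¬a with S? w
      ... | no ¬s = inj₂ (inj₂ (inj₁ (A.reach-step a (inj₂ (¬s , ¬z , ¬k)) e)))
      -- The search behind `x` stops at `S`, but a vertex of `S` lies in `Z` or, being in `Y`, is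
      -- reached from `x` or from `y`.
      ... | yes s with S⇒Z⊎Y s
      ...   | inj₁ z = inj₂ (inj₁ z)
      ...   | inj₂ c = Y⇒whole c

      split : ∀ {v} → Whole v → (Left v ⊎ Right v) ⊎ S v
      split {v} h with S? v | left? v
      ... | yes s | _     = inj₂ s
      ... | no _  | yes l = inj₁ (inj₁ l)
      split (inj₁ k) | no _ | no ¬l                = contradiction (inj₁ k) ¬l
      split (inj₂ (inj₁ z)) | no ¬s | no ¬l        = contradiction (inj₂ (inj₁ (z , ¬s))) ¬l
      split (inj₂ (inj₂ (inj₁ a))) | no ¬s | no ¬l = contradiction (inj₂ (inj₂ a)) ¬l
      split (inj₂ (inj₂ (inj₂ b))) | no ¬s | no ¬l =
        inj₁ (inj₂ (b , (λ z → ¬l (inj₂ (inj₁ (z , ¬s)))) , ¬l ∘ inj₁ , ¬l ∘ inj₂ ∘ inj₂ , ¬s))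

    armsPiece : Piece x
    armsPiece = record
      { Part = Whole ; part? = whole? ; here = inj₂ (inj₁ (k₀ , (k₀x , k₀y) , k₀x)) ; closed = whole-closed
      ; intervals = addToAll
          (concatenate (layeredIntervals left? leftLayering) (layeredIntervals right? (restrict proj₁ B.armLayering))
            (λ v → left? v ⊎-dec right? v) id separated)
          S? S-small whole? split }

  -- The dense case

  -- The six-cycle as K₃,₃ minus a perfect matching, indexed so that `α i` and `β i` are the
  -- unmatched opposite pairs.
  record Hexagon (α β : Fin 3 → V) : Set where
    field
      joined  : ∀ {i j} → i ≢ j → α i ~ β j
      missing : ∀ i → ¬ α i ~ β i

  reflect : ∀ {α β} → Hexagon α β → Hexagon β α
  reflect H = record { joined = λ i≢j → ~-sym (joined (i≢j ∘ ≡-sym)) ; missing = λ i → missing i ∘ ~-sym }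
    where open Hexagon H

  third : ∀ (i j : Fin 3) → i ≢ j → ∃ λ k → k ≢ i × k ≢ j × (∀ l → l ≡ i ⊎ l ≡ j ⊎ l ≡ k)
  third i j i≢j = toWitness {a? = all? λ i → all? λ j → ¬? (i Fin.≟ j) →-dec any? (λ k → ¬? (k Fin.≟ i) ×-dec ¬? (k Fin.≟ j) ×-dec
    all? (λ l → (l Fin.≟ i) ⊎-dec (l Fin.≟ j) ⊎-dec (l Fin.≟ k)))} tt i j i≢j

  other : ∀ (i : Fin 3) → ∃ λ j → j ≢ i
  other zero    = suc zero , λ ()
  other (suc i) = zero , λ ()

  Sees : (Fin 3 → V) → V → Set
  Sees β v = ∀ {i j} → i ≢ j → v ~ β i ⊎ v ~ β j

  -- A label `i` for `v`: only `β i` may be missed. A vertex that sees all three carries every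
  -- label.
  Only : (Fin 3 → V) → V → Fin 3 → Set
  Only β v i = ∀ {j} → j ≢ i → v ~ β j

  only : ∀ {β v i} → Sees β v → ¬ v ~ β i → Only β v i
  only sees v≁ j≢i = [ id , (λ e → contradiction e v≁) ]′ (sees j≢i)

  -- the stirrer seen in the bipartite complement: an induced path z₁…z₅ and two vertices a, b away from it
  co-stirrer-free : ∀ {z₁ z₂ z₃ z₄ z₅ a b} → ¬ z₁ ~ z₂ → ¬ z₂ ~ z₃ → ¬ z₃ ~ z₄ → ¬ z₄ ~ z₅ → z₁ ~ z₄ → z₂ ~ z₅ →
    z₁ ~ a → z₃ ~ a → z₅ ~ a → z₂ ~ b → z₄ ~ b → a ~ b → ⊥
  co-stirrer-free n₁₂ n₂₃ n₃₄ n₄₅ e₁₄ e₂₅ a₁ a₃ a₅ b₂ b₄ ab =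
    stirrer-free ab (~-sym a₁) e₁₄ b₄ (~-sym a₅) (~-sym e₂₅) b₂ (~-sym a₃) n₁₂ (n₄₅ ∘ ~-sym) n₃₄ (n₂₃ ∘ ~-sym)

  -- If `u` sees every `α i`, two squares sharing the edge from `u` to the last of them form a
  -- stirrer with pendant `v`. If `u` misses `α c`, the square `α a`, `u`, `α b`, `β c` with
  -- pendants `β b`, `v`, `β a` is an armchair.
  hexagon-dominates : ∀ {α β u v} → Hexagon α β → Sees α u → u ~ v → ¬ (∀ i → ¬ v ~ β i)
  hexagon-dominates {α} {β} {u} {v} H sees uv far with any? (λ i → ¬? (u ~? α i))
  ... | no all = stirrer-free (u~ (suc (suc zero))) (u~ zero) (joined {zero} {suc zero} λ ()) (~-sym (joined {suc (suc zero)} {suc zero} λ ()))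
                   (u~ (suc zero)) (joined {suc zero} {zero} λ ()) (~-sym (joined {suc (suc zero)} {zero} λ ())) uv
                   (missing zero) (missing (suc zero)) (far (suc zero)) (far zero)
    where
    open Hexagon H
    u~ : ∀ i → u ~ α i
    u~ i = decidable-stable (u ~? α i) λ u≁ → all (i , u≁)
  ... | yes (c , u≁) with other c
  ...   | a , a≢c with third a c a≢c
  ...     | b , b≢a , b≢c , _ = armchair-free (~-sym (only sees u≁ a≢c)) (only sees u≁ b≢c) (joined b≢c) (~-sym (joined a≢c))
              (joined (b≢a ∘ ≡-sym)) uv (joined b≢a) (missing a) (missing b) (far c ∘ ~-sym) (far b) (far a)
    where open Hexagon H

  module Dense {α β : Fin 3 → V} (H : Hexagon α β) {δ : V} (δβ : ∀ i → δ ~ β i) where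

    open Hexagon H

    private
      -- Only a `v` that sees exactly one `β k` is left to exclude; the hexagon has two squares on
      -- the edge from `β k` to `δ`, and `v` is the pendant of a stirrer.
      α-sees : ∀ {u v} → Sees α u → u ~ v → Sees β v
      α-sees {u} {v} sees uv {i} {j} i≢j with v ~? β i | v ~? β j | third i j i≢j
      ... | yes p | _     | _ = inj₁ p
      ... | no _  | yes q | _ = inj₂ q
      ... | no ¬p | no ¬q | k , k≢i , k≢j , all with v ~? β k
      ...   | yes vk = ⊥-elim (stirrer-free (~-sym (δβ k)) (~-sym (joined (k≢i ∘ ≡-sym))) (joined i≢j) (~-sym (δβ j))
                  (~-sym (joined (k≢j ∘ ≡-sym))) (joined (i≢j ∘ ≡-sym)) (~-sym (δβ i)) (~-sym vk) (missing i) (missing j) ¬q ¬p)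
      ...   | no ¬r  = ⊥-elim (hexagon-dominates H sees uv λ l → case all l of λ
                  { (inj₁ refl) → ¬p ; (inj₂ (inj₁ refl)) → ¬q ; (inj₂ (inj₂ refl)) → ¬r })

      -- This is no mirror image of `α-sees`, since `δ` is attached to the `β` side: when `v` sees
      -- exactly one `α k`, its adjacency to `δ` decides between a stirrer and an armchair.
      β-sees : ∀ {u v} → Sees β u → u ~ v → Sees α v
      β-sees {u} {v} sees uv {i} {j} i≢j with v ~? α i | v ~? α j | third i j i≢j
      ... | yes p | _     | _ = inj₁ p
      ... | no _  | yes q | _ = inj₂ q
      ... | no ¬p | no ¬q | k , k≢i , k≢j , all with v ~? α k | v ~? δ
      ...   | no ¬r  | _ = ⊥-elim (hexagon-dominates (reflect H) sees uv λ l → case all l of λ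
                  { (inj₁ refl) → ¬p ; (inj₂ (inj₁ refl)) → ¬q ; (inj₂ (inj₂ refl)) → ¬r })
      ...   | yes vk | yes vδ = ⊥-elim (stirrer-free (δβ k) (δβ j) (~-sym (joined i≢j)) (joined (k≢i ∘ ≡-sym))
                  (δβ i) (~-sym (joined (i≢j ∘ ≡-sym))) (joined (k≢j ∘ ≡-sym)) (~-sym vδ) (missing j ∘ ~-sym) (missing i ∘ ~-sym) ¬p ¬q)
      ...   | yes vk | no v≁δ = ⊥-elim (armchair-free (~-sym (joined k≢i)) (joined k≢j) (~-sym (δβ j)) (δβ i)
                  (~-sym (joined (i≢j ∘ ≡-sym))) (~-sym vk) (~-sym (joined i≢j)) (missing i ∘ ~-sym) (missing j ∘ ~-sym)
                  (v≁δ ∘ ~-sym) ¬q ¬p)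

      SameLabel : (Fin 3 → V) → (Fin 3 → V) → Set
      SameLabel α β = ∀ {t f i j} → Sees β t → Sees α f → ¬ t ~ f → ¬ t ~ β i → ¬ f ~ α j → i ≡ j

      -- For distinct labels, `α i`, `β i`, `t`, `f`, `α j` form a complement path. If `δ` sees `f`,
      -- then `β k` and `δ` complete it to a stirrer; otherwise the square `β i`, `α k`, `β j`, `δ`
      -- carries an armchair.
      sameLabel : SameLabel α β
      sameLabel {t} {f} {i} {j} st sf t≁f t≁ f≁ with i Fin.≟ j
      ... | yes eq = eq
      ... | no i≢j with third i j i≢j | δ ~? f
      ...   | k , k≢i , k≢j , _ | yes δf = ⊥-elim (co-stirrer-free (missing i) (t≁ ∘ ~-sym) t≁f f≁
                (~-sym (only sf f≁ i≢j)) (~-sym (joined (i≢j ∘ ≡-sym)))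
                (joined (k≢i ∘ ≡-sym)) (only st t≁ k≢i) (joined (k≢j ∘ ≡-sym)) (~-sym (δβ i)) (~-sym δf) (~-sym (δβ k)))
      ...   | k , k≢i , k≢j , _ | no δ≁f = ⊥-elim (armchair-free (~-sym (joined k≢i)) (joined k≢j) (~-sym (δβ j)) (δβ i)
                (~-sym (joined (i≢j ∘ ≡-sym))) (~-sym (only sf f≁ k≢j)) (~-sym (only st t≁ (i≢j ∘ ≡-sym)))
                (t≁ ∘ ~-sym) (missing j ∘ ~-sym) δ≁f f≁ (t≁f ∘ ~-sym))

      -- If the labels differ, `f` sees every `α l`, since a missed one would have to match both.
      -- Then `β k` and `α j` complete the complement path `α i`, `β i`, `t`, `f`, `t′` to a
      -- stirrer.
      sameLabel₂ : ∀ {α β} → Hexagon α β → SameLabel α β → ∀ {t f t′ i j} → Sees β t → Sees α f → Sees β t′ →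
        ¬ t ~ f → ¬ f ~ t′ → ¬ t ~ β i → ¬ t′ ~ β j → i ≡ j
      sameLabel₂ {α} {β} H′ same {t} {f} {t′} {i} {j} st sf st′ t≁f f≁t′ t≁ t′≁ with i Fin.≟ j
      ... | yes eq = eq
      ... | no i≢j with third i j i≢j
      ...   | k , k≢i , k≢j , _ = ⊥-elim (co-stirrer-free (H.missing i) (t≁ ∘ ~-sym) t≁f f≁t′ (~-sym (f~ i)) (~-sym (only st′ t′≁ i≢j))
                (H.joined (k≢i ∘ ≡-sym)) (only st t≁ k≢i) (only st′ t′≁ k≢j) (~-sym (H.joined (i≢j ∘ ≡-sym))) (f~ j) (~-sym (H.joined (k≢j ∘ ≡-sym))))
        where
        module H = Hexagon H′
        f~ : ∀ l → f ~ α l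
        f~ l = decidable-stable (f ~? α l) λ f≁ → i≢j (trans (same st sf t≁f t≁ f≁) (≡-sym (same st′ sf (f≁t′ ∘ ~-sym) t′≁ f≁)))

      label : ∀ (β : Fin 3 → V) v → (∃ λ i → ¬ v ~ β i) ⊎ (∀ i → v ~ β i)
      label β v with any? (λ i → ¬? (v ~? β i))
      ... | yes p = inj₁ p
      ... | no ¬p = inj₂ λ i → decidable-stable (v ~? β i) λ v≁ → ¬p (i , v≁)

      confine : ∀ {β v} i → Sees β v → (∀ {j} → ¬ v ~ β j → i ≡ j) → Only β v i
      confine {β} {v} i sees eq {j} j≢i = decidable-stable (v ~? β j) λ v≁ → j≢i (≡-sym (eq v≁))

      someOnly : ∀ {β v} → Sees β v → ∃ (Only β v)
      someOnly {β} {v} sees with label β v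
      ... | inj₁ (i , v≁) = i , only sees v≁
      ... | inj₂ all      = zero , λ _ → all _

      -- Each vertex misses at most one vertex of the opposite triangle, and vertices at distance one or two in the
      -- complement miss matching ones, so an induced complement path z₁…z₅ leaves room for a stirrer.
      no-co-P₅ : ∀ {α β} → Hexagon α β → SameLabel α β → ∀ {z₁ z₂ z₃ z₄ z₅} →
        Sees β z₁ → Sees α z₂ → Sees β z₃ → Sees α z₄ → Sees β z₅ →
        ¬ z₁ ~ z₂ → ¬ z₂ ~ z₃ → ¬ z₃ ~ z₄ → ¬ z₄ ~ z₅ → z₁ ~ z₄ → z₂ ~ z₅ → ⊥
      no-co-P₅ {α} {β} H′ same {z₁} {z₂} {z₃} {z₄} {z₅} s₁ s₂ s₃ s₄ s₅ n₁₂ n₂₃ n₃₄ n₄₅ e₁₄ e₂₅ = go (label β z₃) (label α z₂) (label α z₄)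
        where
        module H = Hexagon H′
        same₂ = sameLabel₂ H′ same
        same₂′ = sameLabel₂ (reflect H′) (λ st sf n t≁ f≁ → ≡-sym (same sf st (n ∘ ~-sym) f≁ t≁))
        finish : ∀ {a b} → a ≢ b → z₁ ~ β a → z₃ ~ β a → z₅ ~ β a → z₂ ~ α b → z₄ ~ α b → ⊥
        finish a≢b a₁ a₃ a₅ b₂ b₄ = co-stirrer-free n₁₂ n₂₃ n₃₄ n₄₅ e₁₄ e₂₅ a₁ a₃ a₅ b₂ b₄ (~-sym (H.joined (a≢b ∘ ≡-sym)))
        uniform : ∀ i → Only β z₁ i → Only α z₂ i → Only β z₃ i → Only α z₄ i → Only β z₅ i → ⊥
        uniform i o₁ o₂ o₃ o₄ o₅ with other i
        ... | a , a≢i with third a i a≢i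
        ...   | b , b≢a , b≢i , _ = finish (b≢a ∘ ≡-sym) (o₁ a≢i) (o₃ a≢i) (o₅ a≢i) (o₂ b≢i) (o₄ b≢i)
        -- When the labels of the end vertices differ, the two indices passed to `finish` are the
        -- third index and the end label other than `m`.
        ends : ∀ i l m → m ≡ i ⊎ m ≡ l → Only β z₁ i → Only β z₅ l → (∀ j → z₃ ~ β j) → Only α z₂ m → Only α z₄ m → ⊥
        ends i l m m≡ o₁ o₅ z₃~ o₂ o₄ with i Fin.≟ l
        ends i .i .i (inj₁ refl) o₁ o₅ z₃~ o₂ o₄ | yes refl = uniform i o₁ o₂ (λ _ → z₃~ _) o₄ o₅
        ends i .i .i (inj₂ refl) o₁ o₅ z₃~ o₂ o₄ | yes refl = uniform i o₁ o₂ (λ _ → z₃~ _) o₄ o₅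
        ends i l m m≡ o₁ o₅ z₃~ o₂ o₄ | no i≢l with third i l i≢l
        ends i l .i (inj₁ refl) o₁ o₅ z₃~ o₂ o₄ | no i≢l | k , k≢i , k≢l , _ =
          finish k≢l (o₁ k≢i) (z₃~ k) (o₅ k≢l) (o₂ (i≢l ∘ ≡-sym)) (o₄ (i≢l ∘ ≡-sym))
        ends i l .l (inj₂ refl) o₁ o₅ z₃~ o₂ o₄ | no i≢l | k , k≢i , k≢l , _ =
          finish k≢i (o₁ k≢i) (z₃~ k) (o₅ k≢l) (o₂ i≢l) (o₄ i≢l)
        go : (∃ λ i → ¬ z₃ ~ β i) ⊎ (∀ i → z₃ ~ β i) → (∃ λ i → ¬ z₂ ~ α i) ⊎ (∀ i → z₂ ~ α i) →
          (∃ λ i → ¬ z₄ ~ α i) ⊎ (∀ i → z₄ ~ α i) → ⊥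
        go (inj₁ (i , n)) _ _ = uniform i
          (confine i s₁ (same₂ s₃ s₂ s₁ (n₂₃ ∘ ~-sym) (n₁₂ ∘ ~-sym) n)) (confine i s₂ (same s₃ s₂ (n₂₃ ∘ ~-sym) n)) (only s₃ n)
          (confine i s₄ (same s₃ s₄ n₃₄ n)) (confine i s₅ (same₂ s₃ s₄ s₅ n₃₄ n₄₅ n))
        go (inj₂ z₃~) (inj₁ (i , n)) _ = let (l , o₅) = someOnly s₅ in ends i l i (inj₁ refl)
          (confine i s₁ (λ n₁ → ≡-sym (same s₁ s₂ n₁₂ n₁ n))) o₅ z₃~ (only s₂ n)
          (confine i s₄ (same₂′ s₂ s₃ s₄ n₂₃ n₃₄ n))
        go (inj₂ z₃~) (inj₂ z₂~) (inj₁ (i , n)) = let (l , o₁) = someOnly s₁ in ends l i i (inj₂ refl)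
          o₁ (confine i s₅ (λ n₅ → ≡-sym (same s₅ s₄ (n₄₅ ∘ ~-sym) n₅ n))) z₃~ (λ _ → z₂~ _) (only s₄ n)
        go (inj₂ z₃~) (inj₂ z₂~) (inj₂ z₄~) = let (i , o₁) = someOnly s₁ ; (l , o₅) = someOnly s₅ in
          ends i l i (inj₁ refl) o₁ o₅ z₃~ (λ _ → z₂~ _) (λ _ → z₄~ _)

    open Search (α zero) {λ _ → ⊤} (λ _ → yes tt)

    private
      triangle-sees : ∀ {α β} → Hexagon α β → ∀ i → Sees β (α i)
      triangle-sees H′ i {j} {k} j≢k with i Fin.≟ j
      ... | no i≢j   = inj₁ (Hexagon.joined H′ i≢j)
      ... | yes refl = inj₂ (Hexagon.joined H′ j≢k)

      SeesOpposite : V → Set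
      SeesOpposite v = (colour v ≡ colour (α zero) → Sees β v) × (colour v ≢ colour (α zero) → Sees α v)

      within-sees : ∀ k {v} → Within k v → SeesOpposite v
      within-sees zero refl = (λ _ → triangle-sees H zero) , λ c → contradiction refl c
      within-sees (suc k) (inj₁ w) = within-sees k w
      within-sees (suc k) {v} (inj₂ (_ , u , wu , uv)) =
        (λ c → α-sees (proj₂ (within-sees k wu) λ c′ → proper _ _ uv (trans c′ (≡-sym c))) uv) ,
        (λ c → β-sees (proj₁ (within-sees k wu) (≢-≢⇒≡ (proper _ _ uv) (c ∘ ≡-sym))) uv)

      sees : ∀ {v} → Reach v → SeesOpposite v
      sees r = within-sees _ (dist-within r)

      Co : V → V → Set
      Co u w = (Reach u × Reach w) × colour u ≢ colour w × ¬ u ~ w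

      abstract
        co? : ∀ u w → Dec (Co u w)
        co? u w = (reach? u ×-dec reach? w) ×-dec ¬? (colour u Bool.≟ colour w) ×-dec ¬? (u ~? w)

      co-sym : ∀ {u w} → Co u w → Co w u
      co-sym ((r , s) , c , n) = (s , r) , c ∘ ≡-sym , n ∘ ~-sym

      co-P₅ : ∀ {a b c e f} → Co a b → Co b c → Co c e → Co e f → Co a e ⊎ Co b f
      co-P₅ {a} {b} {c} {e} {f} ((ra , rb) , ab , n₁) ((_ , rc) , bc , n₂) ((_ , re) , ce , n₃) ((_ , rf) , ef , n₄)
        with a ~? e | b ~? f | colour a Bool.≟ colour (α zero)
      ... | no a≁e | _ | _ = inj₁ ((ra , re) , (λ eq → ce (trans (≢-≢⇒≡ (bc ∘ ≡-sym) ab) eq)) , a≁e)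
      ... | yes _ | no b≁f | _ = inj₂ ((rb , rf) , (λ eq → ef (trans (≢-≢⇒≡ (ce ∘ ≡-sym) bc) eq)) , b≁f)
      ... | yes ae | yes bf | yes ca = ⊥-elim (no-co-P₅ H sameLabel (proj₁ (sees ra) ca) (proj₂ (sees rb) (λ cb → ab (trans ca (≡-sym cb))))
              (proj₁ (sees rc) (trans c≡a ca)) (proj₂ (sees re) λ c′ → ce (trans (trans c≡a ca) (≡-sym c′)))
              (proj₁ (sees rf) (trans (≢-≢⇒≡ (ef ∘ ≡-sym) ce) (trans c≡a ca))) n₁ n₂ n₃ n₄ ae bf)
        where
        c≡a : colour c ≡ colour a
        c≡a = ≢-≢⇒≡ (bc ∘ ≡-sym) ab
      ... | yes ae | yes bf | no ca = ⊥-elim (no-co-P₅ (reflect H) (λ st sf n t≁ f≁ → ≡-sym (sameLabel sf st (n ∘ ~-sym) f≁ t≁))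
              (proj₂ (sees ra) ca) (proj₁ (sees rb) cb) (proj₂ (sees rc) (ca ∘ trans (≡-sym c≡a)))
              (proj₁ (sees re) (trans (≢-≢⇒≡ (ce ∘ ≡-sym) bc) cb))
              (proj₂ (sees rf) λ c′ → ef (trans (trans (≢-≢⇒≡ (ce ∘ ≡-sym) bc) cb) (≡-sym c′))) n₁ n₂ n₃ n₄ ae bf)
        where
        c≡a : colour c ≡ colour a
        c≡a = ≢-≢⇒≡ (bc ∘ ≡-sym) ab
        cb : colour b ≡ colour (α zero)
        cb = ≢-≢⇒≡ (ab ∘ ≡-sym) (ca ∘ ≡-sym)

      module C = Class co? co-sym co-P₅

      Side : Bool → V → Set
      Side b v = Reach v × colour v ≡ b
      abstract
        side? : ∀ b → Decidable (Side b)
        side? b v = reach? v ×-dec (colour v Bool.≟ b)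

      CoClosed : (V → Set) → Set
      CoClosed W = ∀ {u w} → W u → Co u w → W w

      abstract
        inner? : ∀ {W : V → Set} (W? : Decidable W) b → Decidable (λ v → Side b v × W v)
        inner? W? b v = side? b v ×-dec W? v
        outer? : ∀ {W : V → Set} (W? : Decidable W) b → Decidable (λ v → Side b v × ¬ W v)
        outer? W? b v = side? b v ×-dec ¬? (W? v)

      inner-outer : ∀ {W : V → Set} (W? : Decidable W) b → count (side? b) ≤ count (inner? W? b) + count (outer? W? b)
      inner-outer {W} W? b = count-∪ (side? b) (inner? W? b) (outer? W? b) split
        where
        split : ∀ v → Side b v → (Side b v × W v) ⊎ (Side b v × ¬ W v)
        split v s with W? v
        ... | yes w = inj₁ (s , w)
        ... | no ¬w = inj₂ (s , ¬w)

      -- A vertex inside a co-closed set sees every vertex of the other colour outside it, so two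
      -- large counts would give a biclique.
      balance : ∀ {W : V → Set} (W? : Decidable W) → CoClosed W → ∀ {b c} → b ≢ c →
        ¬ count (inner? W? b) ≤ d → count (outer? W? c) ≤ d
      balance {W} W? closed {b} {c} b≢c big with count (outer? W? c) ≤? d
      ... | yes small = small
      ... | no big′ = ⊥-elim (biclique-free (inner? W? b) (outer? W? c) joined′ (≰⇒> big) (≰⇒> big′))
        where
        joined′ : ∀ {u w} → Side b u × W u → Side c w × ¬ W w → u ~ w
        joined′ {u} {w} ((ru , cu) , wu) ((rw , cw) , ¬w) = decidable-stable (u ~? w) λ u≁w →
          ¬w (closed wu ((ru , rw) , (λ eq → b≢c (trans (≡-sym cu) (trans eq cw))) , u≁w))

      Block : V → V → Set
      Block v x = C.Member v x × Reach x

      abstract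
        block? : ∀ v → Decidable (Block v)
        block? v x = C.member? v x ×-dec reach? x

      block-closed : ∀ v → CoClosed (Block v)
      block-closed v (m , _) co = C.member-closed v m co , proj₂ (proj₁ co)

      -- Nestedness passes from the complement to the graph: the two missing edges beside an
      -- independent pair of edges are themselves an independent pair in the complement.
      block-layering : ∀ v → Layering (Block v)
      block-layering v = twoLevels (colour v) nested
        where
        nested : ∀ {u u′ w w′} → Block v u → Block v u′ → Block v w → Block v w′ →
          colour u ≡ colour v → colour u′ ≡ colour v → u ~ w → u′ ~ w′ → u ~ w′ ⊎ u′ ~ w
        nested {u} {u′} {w} {w′} (mu , ru) (mu′ , ru′) (_ , rw) (_ , rw′) cu cu′ uw u′w′ with u ~? w′ | u′ ~? w
        ... | yes p | _     = inj₁ p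
        ... | no _  | yes q = inj₂ q
        ... | no ¬p | no ¬q = ⊥-elim ([ (λ co → proj₂ (proj₂ co) uw) , (λ co → proj₂ (proj₂ co) u′w′) ]′
                (C.mates-nested v (mate mu cu co) (mate mu′ cu′ co′) co co′))
          where
          mate : ∀ {x y} → C.Member v x → colour x ≡ colour v → Co x y → C.Mate v x
          mate = C.member-mate v λ co → proj₁ (proj₂ co)
          co : Co u w′
          co = (ru , rw′) , (λ eq → proper _ _ u′w′ (trans cu′ (trans (≡-sym cu) eq))) , ¬p
          co′ : Co u′ w
          co′ = (ru′ , rw) , (λ eq → proper _ _ uw (trans cu (trans (≡-sym cu′) eq))) , ¬q

      module _ (big : ∀ b → budget ≤ count (side? b)) where

        over : ∀ {j} b → count (side? b) ≤ j → j ≤ d + d + d → ⊥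
        over b le le′ = <⇒≱ (+-monoʳ-< (d + d) (m<m+n d d≥1)) (≤-trans (big b) (≤-trans le le′))

        -- As `X` is large in colour `b`, it misses at most `d` vertices of colour `not b`. Were the
        -- block small in that colour, the class would have at most 3d vertices. So the block is
        -- large there and misses at most `d` vertices of colour `b`; hence it is large in colour
        -- `b` too.
        spread : ∀ {W : V → Set} (W? : Decidable W) → (∀ b → count (inner? W? b) ≤ d) → ∀ v {X} (X? : Decidable X) → CoClosed X →
          (∀ {u} → X u → W u ⊎ Block v u) → ∀ b → ¬ count (inner? X? b) ≤ d →
          count (outer? (block? v) b) ≤ d × count (outer? (block? v) (not b)) ≤ d
        spread {W} W? small v {X} X? closed split b large = outer-b , outer-c
          where
          b≢not : b ≢ not b
          b≢not = Bool.not-¬ refl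
          outer-b : count (outer? (block? v) b) ≤ d
          outer-b = balance (block? v) (block-closed v) (b≢not ∘ ≡-sym) λ le →
            over (not b) (inner-outer X? (not b)) (+-mono-≤ (≤-trans
              (count-∪ (inner? X? (not b)) (inner? W? (not b)) (inner? (block? v) (not b))
                λ u (s , x) → [ (λ w → inj₁ (s , w)) , (λ t → inj₂ (s , t)) ]′ (split x))
              (+-mono-≤ (small (not b)) le)) (balance X? closed b≢not large))
          outer-c : count (outer? (block? v) (not b)) ≤ d
          outer-c = balance (block? v) (block-closed v) b≢not λ le →
            over b (inner-outer (block? v) b) (≤-trans (+-mono-≤ le outer-b) (m≤m+n (d + d) d))

        -- Blocks are united until some colour occurs more than `d` times; the block added last is
        -- the one sought.
        bigBlock : ∃ λ v → ∀ b → count (outer? (block? v) b) ≤ d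
        bigBlock = go (n G) nobody? (λ ()) (λ b → ≤-trans (≤-reflexive (count-none (inner? nobody? b) λ _ ())) z≤n) (m≤n+m _ _)
          where
          nobody? : Decidable {A = V} (λ _ → ⊥)
          nobody? _ = no λ ()
          both : ∀ v b → count (outer? (block? v) b) ≤ d × count (outer? (block? v) (not b)) ≤ d → ∀ c → count (outer? (block? v) c) ≤ d
          both v false (p , q) false = p
          both v false (p , q) true  = q
          both v true  (p , q) false = q
          both v true  (p , q) true  = p
          go : ∀ fuel {W : V → Set} (W? : Decidable W) → CoClosed W → (∀ b → count (inner? W? b) ≤ d) →
            n G ≤ count W? + fuel → ∃ λ v → ∀ b → count (outer? (block? v) b) ≤ d
          go fuel {W} W? closed small enough with any? (λ v → reach? v ×-dec ¬? (W? v))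
          ... | no none = ⊥-elim (over true (count-mono (side? true) (inner? W? true)
                  (λ v (r , c) → (r , c) , decidable-stable (W? v) λ ¬w → none (v , r , ¬w)))
                  (≤-trans (small true) (≤-trans (m≤m+n d d) (m≤m+n (d + d) d))))
          ... | yes (v , r , ¬w) = next fuel enough (all-small? true) (all-small? false)
            where
            X : V → Set
            X u = W u ⊎ Block v u
            X? : Decidable X
            X? u = W? u ⊎-dec block? v u
            X-closed : CoClosed X
            X-closed (inj₁ w) co = inj₁ (closed w co)
            X-closed (inj₂ t) co = inj₂ (block-closed v t co)
            all-small? : ∀ b → Dec (count (inner? X? b) ≤ d)
            all-small? b = count (inner? X? b) ≤? d
            grow : count W? < count X?
            grow = count-strict W? X? (λ _ → inj₁) v (inj₂ (inj₁ refl , r)) ¬w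
            next : ∀ fuel → n G ≤ count W? + fuel → Dec (count (inner? X? true) ≤ d) → Dec (count (inner? X? false) ≤ d) →
              ∃ λ v → ∀ b → count (outer? (block? v) b) ≤ d
            next _ _ (no large) _ = v , both v true (spread W? small v X? X-closed id true large)
            next _ _ _ (no large) = v , both v false (spread W? small v X? X-closed id false large)
            next zero enough (yes _) (yes _) = contradiction (<-≤-trans grow (count≤m X?))
              (≤⇒≯ (≤-trans enough (≤-reflexive (+-identityʳ _))))
            next (suc f) enough (yes p) (yes q) = go f X? X-closed (λ { true → p ; false → q })
              (≤-trans enough (≤-trans (≤-reflexive (+-suc _ f)) (+-monoˡ-≤ f grow)))

      independentIntervals : ∀ {Q : V → Set} → Decidable Q → (∀ {u v} → Q u → Q v → ¬ u ~ v) → Intervals Q 1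
      independentIntervals Q? independent = record
        { decide = Q? ; start = toℕ ; end = suc ∘ toℕ ; horizon = n G
        ; nonempty = λ _ → ≤-refl ; bounded = λ {v} _ → Fin.toℕ<n v
        ; meets = λ p q e → contradiction e (independent p q)
        ; thin = λ t → count-unique (λ v → Q? v ×-dec (toℕ v ≤? t) ×-dec (t <? suc (toℕ v)))
            λ u v (_ , p , q) (_ , p′ , q′) → Fin.toℕ-injective
              (≤-antisym (≤-trans p (ℕ.s≤s⁻¹ q′)) (≤-trans p′ (ℕ.s≤s⁻¹ q))) }

      -- The opposite class is independent and takes one place per bag, while the fewer than 4d
      -- vertices of colour `b` join every bag.
      sideIntervals : ∀ b → count (side? b) < budget → Intervals Reach budget
      sideIntervals b small = weaken (addToAll
        (independentIntervals (side? (not b)) λ (_ , cu) (_ , cv) → λ e → proper _ _ e (trans cu (≡-sym cv)))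
        (side? b) ≤-refl reach? split) reach? id small
        where
        split : ∀ {v} → Reach v → Side (not b) v ⊎ Side b v
        split {v} r with colour v Bool.≟ b
        ... | yes c = inj₂ (r , c)
        ... | no ¬c = inj₁ (r , Bool.¬-not ¬c)

      blockIntervals : ∀ v → (∀ b → count (outer? (block? v) b) ≤ d) → Intervals Reach budget
      blockIntervals v small = addToAll (layeredIntervals (block? v) (block-layering v))
        (λ u → reach? u ×-dec ¬? (block? v u))
        (≤-trans (count-∪ _ (outer? (block? v) true) (outer? (block? v) false) byColour) (+-mono-≤ (small true) (small false)))
        reach? split
        where
        byColour : ∀ u → Reach u × ¬ Block v u → (Side true u × ¬ Block v u) ⊎ (Side false u × ¬ Block v u)
        byColour u (r , ¬t) with colour u in eq
        ... | true  = inj₁ ((r , refl) , ¬t)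
        ... | false = inj₂ ((r , refl) , ¬t)
        split : ∀ {u} → Reach u → Block v u ⊎ (Reach u × ¬ Block v u)
        split {u} r with block? v u
        ... | yes t = inj₁ t
        ... | no ¬t = inj₂ (r , ¬t)

      denseIntervals : Intervals Reach budget
      denseIntervals with budget ≤? count (side? true) | budget ≤? count (side? false)
      ... | no small | _        = sideIntervals true (≰⇒> small)
      ... | yes _    | no small = sideIntervals false (≰⇒> small)
      ... | yes p    | yes q    = case bigBlock (λ { true → p ; false → q }) of λ (v , small) → blockIntervals v small

    densePiece : Piece (α zero)
    densePiece = record
      { Part = Reach ; part? = reach? ; here = reach-root
      ; closed = λ r e → reach-step r tt e ; intervals = denseIntervals }

  -- The extremal pair

  Common Union : V → V → V → Set
  Common x y u = u ~ x × u ~ y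
  Union x y u  = u ~ x ⊎ u ~ y

  common? : ∀ x y → Decidable (Common x y)
  common? x y u = (u ~? x) ×-dec (u ~? y)
  union? : ∀ x y → Decidable (Union x y)
  union? x y u = (u ~? x) ⊎-dec (u ~? y)

  -- lexicographic: first the common neighbourhood is minimised, then the union maximised
  crossing : V → V → ℕ
  crossing x y = count (common? x y) * suc (n G) + (n G ∸ count (union? x y))

  crossing-≤ : ∀ {x y x′ y′} → (∀ u → Common x y u → Common x′ y′ u) → (∀ u → Union x′ y′ u → Union x y u) →
    crossing x y ≤ crossing x′ y′
  crossing-≤ {x} {y} {x′} {y′} f g = +-mono-≤ (*-monoˡ-≤ _ (count-mono (common? x y) (common? x′ y′) f))
    (∸-monoʳ-≤ _ (count-mono (union? x′ y′) (union? x y) g))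

  crossing-common : ∀ {x y x′ y′} → (∀ u → Common x y u → Common x′ y′ u) →
    ∀ k → Common x′ y′ k → ¬ Common x y k → crossing x y < crossing x′ y′
  crossing-common {x} {y} {x′} {y′} f k c ¬c = begin-strict
    count (common? x y) * suc (n G) + (n G ∸ count (union? x y))
      <⟨ +-monoʳ-< _ (s≤s (m∸n≤m (n G) (count (union? x y)))) ⟩
    count (common? x y) * suc (n G) + suc (n G)
      ≡⟨ +-comm (count (common? x y) * suc (n G)) _ ⟩
    suc (count (common? x y)) * suc (n G)
      ≤⟨ *-monoˡ-≤ _ (count-strict (common? x y) (common? x′ y′) f k c ¬c) ⟩
    count (common? x′ y′) * suc (n G)
      ≤⟨ m≤m+n _ _ ⟩
    crossing x′ y′ ∎
    where open ≤-Reasoning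

  crossing-union : ∀ {x y x′ y′} → (∀ u → Common x y u → Common x′ y′ u) → (∀ u → Union x′ y′ u → Union x y u) →
    ∀ w → Union x y w → ¬ Union x′ y′ w → crossing x y < crossing x′ y′
  crossing-union {x} {y} {x′} {y′} f g w u ¬u = +-mono-≤-< (*-monoˡ-≤ _ (count-mono (common? x y) (common? x′ y′) f))
    (∸-monoʳ-< (count-strict (union? x′ y′) (union? x y) g w u ¬u) (count≤m (union? x y)))

  swap : ∀ {x y} → Incomparable x y → Incomparable y x
  swap ((k , kx , ky) , p , q) = (k , ky , kx) , q , p

  module Minimal {Live : V → Set} (live-closed : ∀ {u w} → Live u → u ~ w → Live w) where

    Least : V → V → Set
    Least x y = Live x × Incomparable x y × (∀ x′ y′ → Live x′ × Incomparable x′ y′ → crossing x y ≤ crossing x′ y′)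

    least-swap : ∀ {x y} → Least x y → Least y x
    least-swap (l , inc@((k , kx , ky) , _) , min) = live-closed (live-closed l (~-sym kx)) ky , swap inc ,
      λ x′ y′ c → ≤-trans (crossing-≤ (λ _ (a , b) → b , a) (λ _ → [ inj₂ , inj₁ ]′)) (min x′ y′ c)

    private
      beats : ∀ {x y z k p q} → Least x y → k ~ x → k ~ y → k ~ z → p ~ z → ¬ p ~ y → q ~ y → ¬ q ~ z →
        ¬ crossing z y < crossing x y
      beats (l , _ , min) kx ky kz pz p≁y qy q≁z lt = <⇒≱ lt (min _ _
        (live-closed (live-closed l (~-sym kx)) kz , (_ , kz , ky) , (_ , pz , p≁y) , (_ , qy , q≁z)))

      -- Otherwise `z` could replace `x`. Private neighbours of `y` miss `z`, by a stirrer on the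
      -- edge `z k` with pendant `w`, so no common neighbour is gained. The union loses nothing,
      -- since a lost `u` would give a tripod at `k`, and it gains `w`.
      outside : ∀ {x y k z w p} → Least x y → k ~ x → k ~ y → k ~ z → w ~ z → ¬ w ~ x → ¬ w ~ y →
        p ~ x → ¬ p ~ y → ¬ p ~ z
      outside {x} {y} {k} {z} {w} {p} least@(_ , (_ , _ , (q , qy , q≁x)) , _) kx ky kz wz w≁x w≁y px p≁y pz =
        beats least kx ky kz pz p≁y qy (misses qy q≁x) (crossing-union
          (λ u (uz , uy) → decidable-stable (u ~? x) (λ u≁x → misses uy u≁x uz) , uy)
          (λ { u (inj₂ uy) → inj₂ uy ; u (inj₁ ux) → both-sides u ux })
          w (inj₁ wz) [ w≁x , w≁y ]′)
        where
        misses : ∀ {q} → q ~ y → ¬ q ~ x → ¬ q ~ z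
        misses qy q≁x qz = stirrer-free (~-sym kz) (~-sym pz) px (~-sym kx) (~-sym qz) qy (~-sym ky) (~-sym wz) p≁y q≁x w≁x w≁y
        both-sides : ∀ u → u ~ x → Union z y u
        both-sides u ux with u ~? z | u ~? y
        ... | yes uz | _      = inj₁ uz
        ... | no _   | yes uy = inj₂ uy
        ... | no u≁z | no u≁y = ⊥-elim (tripod-free kx (~-sym ux) ky (~-sym qy) kz (~-sym wz)
                (q≁x ∘ ~-sym) (w≁x ∘ ~-sym) (u≁y ∘ ~-sym) (w≁y ∘ ~-sym) (u≁z ∘ ~-sym) (misses qy q≁x ∘ ~-sym))

    -- If not, `k` is the centre of a tripod with legs `x p`, `y q`, `z w`; `outside`, applied to
    -- both orders of the pair, keeps `z` away from `p` and `q`.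
    within : ∀ {x y k z w} → Least x y → k ~ x → k ~ y → k ~ z → w ~ z → w ~ x ⊎ w ~ y
    within {x} {y} {k} {z} {w} least@(_ , (_ , (p , px , p≁y) , (q , qy , q≁x)) , _) kx ky kz wz with w ~? x | w ~? y
    ... | yes wx | _      = inj₁ wx
    ... | no _   | yes wy = inj₂ wy
    ... | no w≁x | no w≁y = ⊥-elim (tripod-free kx (~-sym px) ky (~-sym qy) kz (~-sym wz)
            (q≁x ∘ ~-sym) (w≁x ∘ ~-sym) (p≁y ∘ ~-sym) (w≁y ∘ ~-sym)
            (outside least kx ky kz wz w≁x w≁y px p≁y ∘ ~-sym)
            (outside (least-swap least) ky kx kz wz w≁y w≁x qy q≁x ∘ ~-sym))

    -- Otherwise `z` and `y` would be an incomparable pair whose common neighbours all lie among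
    -- those of `x` and `y`, with `k′` lost.
    meets-both : ∀ {x y k k′ z p} → Least x y → k ~ x → k ~ y → k ~ z → p ~ x → ¬ p ~ y → p ~ z →
      k′ ~ x → k′ ~ y → ¬ k′ ~ z → ∃ λ q → q ~ y × ¬ q ~ x × q ~ z
    meets-both {x} {y} {k} {k′} {z} least@(_ , (_ , _ , (q , qy , q≁x)) , _) kx ky kz px p≁y pz k′x k′y k′≁z
      with any? (λ q → (q ~? y) ×-dec ¬? (q ~? x) ×-dec (q ~? z))
    ... | yes hit = hit
    ... | no miss = ⊥-elim (beats least kx ky kz pz p≁y qy (λ qz → miss (q , qy , q≁x , qz)) (crossing-common
            (λ u (uz , uy) → decidable-stable (u ~? x) (λ u≁x → miss (u , uy , u≁x , uz)) , uy)
            k′ (k′x , k′y) (k′≁z ∘ proj₁)))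

  DenseSpot : V → V → V → Set
  DenseSpot x y z = (∃ λ p → p ~ x × ¬ p ~ y × p ~ z) × (∃ λ q → q ~ y × ¬ q ~ x × q ~ z) ×
    (∃ λ k → Common x y k × k ~ z) × (∃ λ k′ → Common x y k′ × ¬ k′ ~ z)

  denseSpot? : ∀ x y → Decidable (DenseSpot x y)
  denseSpot? x y z = any? (λ p → (p ~? x) ×-dec ¬? (p ~? y) ×-dec (p ~? z))
    ×-dec any? (λ q → (q ~? y) ×-dec ¬? (q ~? x) ×-dec (q ~? z))
    ×-dec any? (λ k → common? x y k ×-dec (k ~? z)) ×-dec any? (λ k → common? x y k ×-dec ¬? (k ~? z))

  -- The hexagon pairs `k′`, `p`, `q` with `z`, `y`, `x`, the vertices they miss, and `k` is the
  -- vertex that sees all of the latter.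
  densePieceAt : ∀ {x y z} → DenseSpot x y z → ∃ λ k → k ~ x × Piece k
  densePieceAt {x} {y} {z} ((p , px , p≁y , pz) , (q , qy , q≁x , qz) , (k , (kx , ky) , kz) , (k′ , (k′x , k′y) , k′≁z)) =
    k′ , k′x , Dense.densePiece {α} {β} hexagon {k} dominates
    where
    α β : Fin 3 → V
    α zero             = k′
    α (suc zero)       = p
    α (suc (suc zero)) = q
    β zero             = z
    β (suc zero)       = y
    β (suc (suc zero)) = x
    joined : ∀ i j → i ≢ j → α i ~ β j
    joined zero zero i≢i = contradiction refl i≢i
    joined zero (suc zero) _ = k′y
    joined zero (suc (suc zero)) _ = k′x
    joined (suc zero) zero _ = pz
    joined (suc zero) (suc zero) i≢i = contradiction refl i≢i
    joined (suc zero) (suc (suc zero)) _ = px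
    joined (suc (suc zero)) zero _ = qz
    joined (suc (suc zero)) (suc zero) _ = qy
    joined (suc (suc zero)) (suc (suc zero)) i≢i = contradiction refl i≢i
    hexagon : Hexagon α β
    hexagon = record
      { joined  = joined _ _
      ; missing = λ { zero → k′≁z ; (suc zero) → p≁y ; (suc (suc zero)) → q≁x } }
    dominates : ∀ i → k ~ β i
    dominates zero             = kz
    dominates (suc zero)       = ky
    dominates (suc (suc zero)) = kx

  incomparable-piece : ∀ {Live : V → Set} (live-closed : ∀ {u w} → Live u → u ~ w → Live w) →
    ∀ {x y} → Minimal.Least live-closed x y → ∃ λ v → Live v × Piece v
  incomparable-piece {Live} live-closed {x} {y} least@(lx , ((k₀ , k₀x , k₀y) , (p₀ , p₀x , p₀≁y) , _) , _)
    with any? (denseSpot? x y)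
  ... | yes (z , spot) = case densePieceAt spot of λ (k , kx , piece) → k , live-closed lx (~-sym kx) , piece
  ... | no sparse = x , lx , Arms.armsPiece k₀x k₀y p₀x p₀≁y (Minimal.within live-closed least) saturated
    where
    -- A neighbour `w` of `z` outside the common neighbourhood is private to `x` or to `y`. If `z`
    -- missed `k′`, then `meets-both` would find one private to the other, and `z` would be a dense
    -- spot.
    saturated : ∀ {k k′ z w} → k ~ x → k ~ y → k ~ z → w ~ z → ¬ (w ~ x × w ~ y) → k′ ~ x → k′ ~ y → k′ ~ z
    saturated {k} {k′} {z} {w} kx ky kz wz ¬k k′x k′y = decidable-stable (k′ ~? z) λ k′≁z →
      case Minimal.within live-closed least kx ky kz wz of λ
        { (inj₁ wx) → case Minimal.meets-both live-closed least kx ky kz wx (¬k ∘ (wx ,_)) wz k′x k′y k′≁z of λ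
            (q , qy , q≁x , qz) → sparse (z , (w , wx , ¬k ∘ (wx ,_) , wz) , (q , qy , q≁x , qz) , (k , (kx , ky) , kz) , (k′ , (k′x , k′y) , k′≁z))
        ; (inj₂ wy) → case Minimal.meets-both live-closed (Minimal.least-swap live-closed least) ky kx kz wy (¬k ∘ (_, wy)) wz k′y k′x k′≁z of λ
            (p , px , p≁y , pz) → sparse (z , (p , px , p≁y , pz) , (w , wy , ¬k ∘ (_, wy) , wz) , (k , (kx , ky) , kz) , (k′ , (k′x , k′y) , k′≁z)) }

  -- Choice of the next piece, and the width bound

  peel : ∀ {Live : V → Set} → Decidable Live → (∀ {u w} → Live u → u ~ w → Live w) → ∃ Live → ∃ λ v → Live v × Piece v
  peel {Live} live? live-closed (v , lv) with any? (λ x → any? λ y → live? x ×-dec incomparable? x y)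
  ... | no none = v , lv , comparable-piece live? live-closed (λ lx inc → none (_ , _ , lx , inc)) lv
  ... | yes some = case argmin₂ (λ x y → live? x ×-dec incomparable? x y) crossing some of λ
      (x , y , (lx , inc) , min) → incomparable-piece live-closed (lx , inc , min)

  budget≤ : budget ≤ suc (4 * d ∸ 1)
  budget≤ = ≤-trans (≤-reflexive (trans (+-assoc d d (d + d)) (cong (λ e → d + (d + (d + e))) (≡-sym (+-identityʳ d)))))
                    (m≤n+m∸n (4 * d) 1)

  pathwidth-bound : PathwidthAtMost G (4 * d ∸ 1)
  pathwidth-bound = intervals⇒pathwidth (cover peel) (λ _ → tt) budget≤

theorem21 : (d : ℕ) → d ≥ 1 → (G : Graph) → Bipartite G →
    InducedFree G armchair → InducedFree G stirrer → InducedFree G tripod →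
    InducedFree G (completeBipartite (suc d)) →
    PathwidthAtMost G (4 * d ∸ 1)
theorem21 d d≥1 G (colour , proper) noArmchair noStirrer noTripod noBiclique =
  Proof.pathwidth-bound G colour proper d d≥1 noArmchair noStirrer noTripod noBiclique
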